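{- There exist infinitely many positive integers $n$ such that for every integer $\ell$ with $3\leq \ell\leq \frac{n-1}{12\log n}+2$ we have $$M_{\mathcal{F}_{\ell}}(n)\geq 2^{n-2}.$$ In particular, this holds whenever $n\geq 64$ and $n=p$ or $n=2p-1$ for some odd prime $p$.
   Context: Logarithms are base 2. For graphs $G,G'$ on the same vertex set $[n]=\{1,\dots,n\}$, their symmetric difference $G\oplus G'$ is the graph on $[n]$ whose edge set consists of all edges belonging to exactly one of $G,G'$. For a class $\mathcal{F}$ of graphs, a family $\mathcal{G}$ of graphs on vertex set $[n]$ is $\mathcal{F}$-good if $G\oplus G'\in\mathcal{F}$ for every pair of distinct $G,G'\in\mathcal{G}$; $M_{\mathcal{F}}(n)$ denotes the maximum possible size of an $\mathcal{F}$-good family of graphs on $[n]$. $\mathcal{F}_{\ell}$ denotes the class of graphs containing a spanning tree with exactly $\ell$ leaves. -}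

module Defs where

open import Data.Bool using (Bool; true; false; T; _xor_)
open import Data.Fin using (Fin)
open import Data.Fin.Subset using (Subset; ∣_∣)
open import Data.List using (List; _∷_; _∷ʳ_; length)
open import Data.List.Relation.Unary.Linked using (Linked)
import Data.List.Membership.Setoid as SetoidMembership
import Data.List.Relation.Unary.Unique.Propositional as Propositional
import Data.List.Relation.Unary.Unique.Setoid as UniqueSetoid
open import Data.Nat using (ℕ; _*_; _∸_; _^_; _≤_; _≟_)
open import Data.Product using (_×_; ∃-syntax)
open import Data.Vec using (tabulate)
open import Level using (0ℓ)
open import Relation.Binary.Bundles using (Setoid)
open import Relation.Binary.Construct.Closure.ReflexiveTransitive using (Star)
open import Relation.Binary.PropositionalEquality
  using (_≡_; refl; sym; trans; cong₂)
open import Relation.Nullary using (¬_; does)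

record Graph (n : ℕ) : Set where
  field
    adj        : Fin n → Fin n → Bool
    adj-sym    : ∀ u v → adj u v ≡ adj v u
    adj-irrefl : ∀ u → adj u u ≡ false

open Graph public

Adj : ∀ {n} → Graph n → Fin n → Fin n → Set
Adj G u v = T (adj G u v)

-- Two graphs on the same vertex set are identified when they have the same
-- edges; without function extensionality this is coarser than _≡_.
infix 4 _≈ᴳ_
_≈ᴳ_ : ∀ {n} → Graph n → Graph n → Set
G ≈ᴳ H = ∀ u v → adj G u v ≡ adj H u v

graphSetoid : ℕ → Setoid 0ℓ 0ℓ
graphSetoid n = record
  { Carrier       = Graph n
  ; _≈_           = _≈ᴳ_
  ; isEquivalence = record
    { refl  = λ u v → refl
    ; sym   = λ e u v → sym (e u v)
    ; trans = λ e f u v → trans (e u v) (f u v)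
    }
  }

infixl 6 _⊕_
_⊕_ : ∀ {n} → Graph n → Graph n → Graph n
(G ⊕ H) .adj u v        = adj G u v xor adj H u v
(G ⊕ H) .adj-sym u v    = cong₂ _xor_ (adj-sym G u v) (adj-sym H u v)
(G ⊕ H) .adj-irrefl u   = cong₂ _xor_ (adj-irrefl G u) (adj-irrefl H u)

GraphClass : Set₁
GraphClass = ∀ n → Graph n → Set

Connected : ∀ {n} → Graph n → Set
Connected G = ∀ u v → Star (Adj G) u v

-- The cycle visits v, then the vertices of vs in order, and returns to v.
IsCycle : ∀ {n} → Graph n → Fin n → List (Fin n) → Set
IsCycle G v vs =
    2 ≤ length vs
  × Propositional.Unique (v ∷ vs)
  × Linked (Adj G) (v ∷ (vs ∷ʳ v))

Acyclic : ∀ {n} → Graph n → Set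
Acyclic G = ∀ v vs → ¬ IsCycle G v vs

IsTree : ∀ {n} → Graph n → Set
IsTree G = Connected G × Acyclic G

-- A subgraph of G that is a tree on the whole vertex set of G.
IsSpanningTree : ∀ {n} → Graph n → Graph n → Set
IsSpanningTree G S = IsTree S × (∀ u v → Adj S u v → Adj G u v)

degree : ∀ {n} → Graph n → Fin n → ℕ
degree G v = ∣ tabulate (adj G v) ∣

leaves : ∀ {n} → Graph n → Subset n
leaves G = tabulate λ v → does (degree G v ≟ 1)

𝓕 : ℕ → GraphClass
𝓕 ℓ n G = ∃[ S ] IsSpanningTree G S × ∣ leaves S ∣ ≡ ℓ

-- A family of graphs is a duplicate-free list, so that its size is its length.
module _ {n : ℕ} where
  open SetoidMembership (graphSetoid n) using (_∈_)
  open UniqueSetoid (graphSetoid n) using (Unique)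

  IsFamily : List (Graph n) → Set
  IsFamily = Unique

  Good : GraphClass → List (Graph n) → Set
  Good F 𝒢 = ∀ {G H} → G ∈ 𝒢 → H ∈ 𝒢 → ¬ (G ≈ᴳ H) → F n (G ⊕ H)

-- M[ F , n ]≡ m says that m is the maximum size of an F-good family on n
-- vertices: it is attained and it is an upper bound.
M[_,_]≡_ : GraphClass → ℕ → ℕ → Set
M[ F , n ]≡ m =
    (∃[ 𝒢 ] IsFamily {n} 𝒢 × Good F 𝒢 × length 𝒢 ≡ m)
  × (∀ (𝒢 : List (Graph n)) → IsFamily 𝒢 → Good F 𝒢 → length 𝒢 ≤ m)

-- The real inequality b · log₂ n ≤ a, for n ≥ 1, after applying the strictly
-- increasing map x ↦ 2 ^ x to both sides.
infix 4 _·log₂_≤_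
_·log₂_≤_ : ℕ → ℕ → ℕ → Set
b ·log₂ n ≤ a = n ^ b ≤ 2 ^ a

-- The second hypothesis is ℓ ≤ (n - 1) / (12 log₂ n) + 2 with the denominator
-- (positive for n ≥ 2) cleared; the truncated subtraction ℓ ∸ 2 is exact
-- because 3 ≤ ℓ.
LowerBound : ℕ → Set
LowerBound n =
  ∀ ℓ → 3 ≤ ℓ → 12 * (ℓ ∸ 2) ·log₂ n ≤ n ∸ 1 →
  ∃[ m ] M[ 𝓕 ℓ , n ]≡ m × 2 ^ (n ∸ 2) ≤ m

{-# OPTIONS --safe #-}
module Submission where

-- Colour the edges of the complete graph on n vertices with n colours so that any two colour
-- classes a, b form a Hamiltonian path. To a set x of even size of the colours other than a
-- reserved one, attach the graph of all edges whose colour is in x; symmetric differences of such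
-- graphs correspond to symmetric differences of sets, so each contains two colour classes and hence
-- a Hamiltonian path. A path together with a matching of 3t + 1 chords has a spanning tree with
-- t + 2 leaves. If the symmetric difference has a third colour, that colour provides the chords.
-- Otherwise it is {i, j}, and the edges of the reserved colour provide them: these are cut into
-- one block for each binary digit, and the b-th block is put into the graph of x when an odd number
-- of the colours in x have b-th digit 0, so that a whole block survives in the difference.

-- The size `2 ^ (n ∸ 2)` is that of the space of even subsets of the `n - 1` unreserved colours;
-- evenness guarantees that a nonzero difference has at least two colours. The obstacle is a
-- difference of exactly two: it supplies a bare path, with two leaves and no chord, so one colour
-- is spent on chords. Parities against binary digits are linear over the two-element field, hence
-- what survives in the reserved colour depends on the difference alone. The 12 arises as follows.
-- With `2 ^ L ≤ n ≤ 2 ^ (L + 1)`, the `L + 1` blocks of `3t + 1` disjoint edges occupy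
-- `2 (L + 1)(3t + 1)` vertices; `2 (L + 1) ≤ 3L` and `3t + 1 ≤ 4t` bound this by `12 t L`. The
-- colourings rest on one fact: two distinct reflections of ℤ/p compose to a nonzero translation,
-- which has order p, so an alternating walk cannot close early. Since `LowerBound` asserts that the
-- maximum exists, membership in `𝓕 ℓ` also has to be decided by finite search.

open import Defs
open import Algebra using (CommutativeRing)
import Algebra.Properties.CommutativeMonoid.Sum as Sum
open import Data.Bool using (Bool; true; false; not; T; _∧_; _xor_)
import Data.Bool.Properties as Bool
open import Data.Bool.Properties using (T?; ∧-comm; ∧-idem; xor-same)
open import Data.Empty using (⊥)
open import Data.Fin as Fin
  using (Fin; zero; suc; toℕ; fromℕ; fromℕ<; inject₁; finToFun; funToFin; punchOut; combine; splitAt; join; _↑ˡ_; _↑ʳ_)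
import Data.Fin.Properties as Fin
import Data.Fin.Subset as Subset
import Data.Integer as Int
open import Data.Integer using (ℤ; +_; 0ℤ; 1ℤ; -1ℤ; ∣_∣; _%ℕ_; _/ℕ_)
import Data.Integer.DivMod as ℤ
open import Data.Integer.Divisibility.Signed
  using (divides; ∣⇒∣ᵤ; ∣ᵤ⇒∣; ∣n⇒∣m*n; ∣m∣n⇒∣m+n) renaming (_∣_ to _∣ℤ_)
import Data.Integer.Properties as ℤ
open import Data.Integer.Tactic.RingSolver using (solve-∀)
open import Data.List using (List; []; _∷_; _∷ʳ_; length; lookup; filter)
import Data.List as List
import Data.List.Membership.Setoid as SetoidMembership
import Data.List.Membership.Setoid.Properties as SetoidMembershipₚ
open import Data.List.Membership.Propositional using (_∈_)
open import Data.List.Membership.Propositional.Properties using (∈-lookup)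
import Data.List.Properties as List
open import Data.List.Relation.Unary.All as All using (All; []; _∷_)
import Data.List.Relation.Unary.All.Properties as All
open import Data.List.Relation.Unary.AllPairs as AllPairs using (AllPairs; []; _∷_)
import Data.List.Relation.Unary.AllPairs.Properties as AllPairs
open import Data.List.Relation.Unary.Any using (here; there)
open import Data.List.Relation.Unary.Linked as Linked using (Linked; _∷_)
import Data.List.Relation.Unary.Unique.DecPropositional as DecUnique
open import Data.Nat hiding (parity; _/_; _%_)
open import Data.Nat.DivMod
  using (_/_; _%_; m%n<n; m≡m%n+[m/n]*n; m<n⇒m/n≡0; m<n*o⇒m/o<n; m*n/n≡m; +-distrib-/-∣ʳ)
open import Data.Nat.Divisibility
  using (_∣_; _∤_; divides-refl; ∣-refl; ∣-trans; ∣⇒≤; m∣m*n; m≤n⇒m!∣n!; ∣m+n∣m⇒∣n; ∣1⇒≡1)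
import Data.Nat.Divisibility as Nat using (divides)
open import Data.Nat.ListAction using (product)
open import Data.Nat.Primality
  using (Prime; euclidsLemma; prime⇒nonZero; prime⇒irreducible; ¬prime[0]; ¬prime[1])
open import Data.Nat.Primality.Factorisation using (factorise; PrimeFactorisation)
open import Data.Nat.Properties
open import Data.Nat.Tactic.RingSolver using () renaming (solve-∀ to solveℕ-∀)
open import Data.Product hiding (swap)
open import Data.Sum using (_⊎_; inj₁; inj₂; [_,_]′; swap)
open import Data.Unit using (⊤; tt)
open import Data.Vec using (tabulate)
open import Data.Vec.Functional using (removeAt)
open import Data.Vec.Properties using (tabulate-cong)
open import Function using (_∘_; id; Inverse)
open import Level using (Level)
open import Relation.Binary using (Rel; Symmetric; tri<; tri≈; tri>)
open import Relation.Binary.Construct.Closure.ReflexiveTransitive as Star using (Star; ε; _◅_)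
open import Relation.Binary.PropositionalEquality hiding ([_])
open import Relation.Nullary
open import Relation.Nullary.Decidable using (map′; dec-true; toWitness; fromWitness)
open import Relation.Unary using (Pred; Decidable)

open Sum (CommutativeRing.+-commutativeMonoid Bool.xor-∧-commutativeRing)
  using (sum; sum-remove; ∑-distrib-+; sum-cong-≗; sum-replicate-zero)
open Int using () renaming (_+_ to _+ᶻ_; _-_ to _-ᶻ_; -_ to -ᶻ_; _*_ to _*ᶻ_)

-- The maximum size of a good family exists

-- Floyd–Warshall: the intermediate vertices of the walk are smaller than k.
module _ {n : ℕ} (G : Graph n) where

  Via : ℕ → Fin n → Fin n → Set
  Via zero    u v = u ≡ v ⊎ Adj G u v
  Via (suc k) u v = Via k u v ⊎ ∃[ w ] toℕ w ≡ k × Via k u w × Via k w v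

  via? : ∀ k u v → Dec (Via k u v)
  via? zero    u v = (u Fin.≟ v) ⊎-dec T? (adj G u v)
  via? (suc k) u v = via? k u v ⊎-dec
    Fin.any? (λ w → (toℕ w ≟ k) ×-dec via? k u w ×-dec via? k w v)

  via⇒star : ∀ k {u v} → Via k u v → Star (Adj G) u v
  via⇒star zero    (inj₁ refl) = ε
  via⇒star zero    (inj₂ e)    = e ◅ ε
  via⇒star (suc k) (inj₁ p)    = via⇒star k p
  via⇒star (suc k) (inj₂ (_ , _ , p , q)) = via⇒star k p Star.◅◅ via⇒star k q

  -- Joining two walks may visit the same intermediate vertex twice, which `Via` has no room for;
  -- the closed detour between the two visits is cut out.
  via-trans : ∀ k {u w v} → toℕ w < k → Via k u w → Via k w v → Via k u v
  via-trans (suc k) {w = w} w<1+k p q with m<1+n⇒m<n∨m≡n w<1+k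
  ... | inj₂ w≡k = inj₂ (w , w≡k , to p , from q)
    where
    to : ∀ {u} → Via (suc k) u w → Via k u w
    to (inj₁ p) = p
    to (inj₂ (x , x≡k , p , _)) with Fin.toℕ-injective (trans x≡k (sym w≡k))
    ... | refl = p
    from : ∀ {v} → Via (suc k) w v → Via k w v
    from (inj₁ q) = q
    from (inj₂ (x , x≡k , _ , q)) with Fin.toℕ-injective (trans x≡k (sym w≡k))
    ... | refl = q
  ... | inj₁ w<k with p | q
  ...   | inj₁ p  | inj₁ q = inj₁ (via-trans k w<k p q)
  ...   | inj₁ p  | inj₂ (x , x≡k , q , q′) = inj₂ (x , x≡k , via-trans k w<k p q , q′)
  ...   | inj₂ (x , x≡k , p , p′) | inj₁ q  = inj₂ (x , x≡k , p , via-trans k w<k p′ q)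
  ...   | inj₂ (x , x≡k , p , _)  | inj₂ (y , y≡k , _ , q)
    with Fin.toℕ-injective (trans x≡k (sym y≡k))
  ...     | refl = inj₂ (x , x≡k , p , q)

  via-weaken : ∀ k {u v} → Via 0 u v → Via k u v
  via-weaken zero    p = p
  via-weaken (suc k) p = inj₁ (via-weaken k p)

  star⇒via : ∀ {u v} → Star (Adj G) u v → Via n u v
  star⇒via ε = via-weaken n (inj₁ refl)
  star⇒via (_◅_ {j = w} e s) = via-trans n (Fin.toℕ<n w) (via-weaken n (inj₂ e)) (star⇒via s)

  connected? : Dec (Connected G)
  connected? = Fin.all? λ u → Fin.all? λ v →
    map′ (via⇒star n) star⇒via (via? n u v)

allPairs-lookup : ∀ {a ℓ} {A : Set a} {R : Rel A ℓ} → Symmetric R →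
  ∀ {xs} → AllPairs R xs → ∀ {i j} → i ≢ j → R (lookup xs i) (lookup xs j)
allPairs-lookup s (r ∷ rs) {zero}  {zero}  i≢j = contradiction refl i≢j
allPairs-lookup s (r ∷ rs) {zero}  {suc j} i≢j = All.lookup r (∈-lookup j)
allPairs-lookup s (r ∷ rs) {suc i} {zero}  i≢j = s (All.lookup r (∈-lookup i))
allPairs-lookup s (r ∷ rs) {suc i} {suc j} i≢j = allPairs-lookup s rs (i≢j ∘ cong suc)

injective : ∀ {a b} {A : Set a} {B : Set b} → (A → B) → Set _
injective f = ∀ {x y} → f x ≡ f y → x ≡ y

unique-length≤ : ∀ {n} {xs : List (Fin n)} → AllPairs _≢_ xs → length xs ≤ n
unique-length≤ {xs = xs} u = Fin.injective⇒≤ lookup-injective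
  where
  lookup-injective : injective (lookup xs)
  lookup-injective {i} {j} eq with i Fin.≟ j
  ... | yes i≡j = i≡j
  ... | no  i≢j = contradiction eq (allPairs-lookup (λ x≢y → x≢y ∘ sym) u i≢j)

∃-list? : ∀ {n p} k {P : Pred (List (Fin n)) p} → Decidable P → Dec (∃[ xs ] length xs ≤ k × P xs)
∃-list? zero P? = map′ (λ p → [] , z≤n , p) (λ { ([] , _ , p) → p }) (P? [])
∃-list? (suc k) {P} P? =
  map′ to from (P? [] ⊎-dec Fin.any? λ x → ∃-list? k (λ xs → P? (x ∷ xs)))
  where
  to : P [] ⊎ (∃[ x ] ∃[ xs ] length xs ≤ k × P (x ∷ xs)) → ∃[ xs ] length xs ≤ suc k × P xs
  to (inj₁ p)                = [] , z≤n , p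
  to (inj₂ (x , xs , l , p)) = x ∷ xs , s≤s l , p
  from : (∃[ xs ] length xs ≤ suc k × P xs) → P [] ⊎ (∃[ x ] ∃[ xs ] length xs ≤ k × P (x ∷ xs))
  from ([]     , _     , p) = inj₁ p
  from (x ∷ xs , s≤s l , p) = inj₂ (x , xs , l , p)

module _ {n : ℕ} (G : Graph n) where

  isCycle? : ∀ v vs → Dec (IsCycle G v vs)
  isCycle? v vs = (2 ≤? length vs) ×-dec DecUnique.unique? Fin._≟_ (v ∷ vs)
    ×-dec Linked.linked? (λ u w → T? (adj G u w)) (v ∷ (vs ∷ʳ v))

  -- A cycle repeats no vertex, so it suffices to search lists of length at most `n`.
  acyclic? : Dec (Acyclic G)
  acyclic? = map′ to from (Fin.all? λ v → ¬? (∃-list? n (isCycle? v)))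
    where
    to : (∀ v → ¬ (∃[ vs ] length vs ≤ n × IsCycle G v vs)) → Acyclic G
    to h v vs c@(_ , u , _) = h v (vs , ≤-trans (n≤1+n _) (unique-length≤ u) , c)
    from : Acyclic G → ∀ v → ¬ (∃[ vs ] length vs ≤ n × IsCycle G v vs)
    from h v (vs , _ , c) = h v vs c

graphOf : ∀ {n} (f : Fin n → Fin n → Bool) → (∀ u v → f u v ≡ f v u) → Graph n
graphOf f f-sym .adj u v with u Fin.≟ v
... | yes _ = false
... | no  _ = f u v
graphOf f f-sym .adj-sym u v with u Fin.≟ v | v Fin.≟ u
... | yes _   | yes _   = refl
... | yes u≡v | no  v≢u = contradiction (sym u≡v) v≢u
... | no  u≢v | yes v≡u = contradiction (sym v≡u) u≢v
... | no  _   | no  _   = f-sym u v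
graphOf f f-sym .adj-irrefl u with u Fin.≟ u
... | yes _   = refl
... | no  u≢u = contradiction refl u≢u

≈ᴳ-sym : ∀ {n} {G H : Graph n} → G ≈ᴳ H → H ≈ᴳ G
≈ᴳ-sym G≈H u v = sym (G≈H u v)

⊕-cong : ∀ {n} {G G′ H H′ : Graph n} → G ≈ᴳ G′ → H ≈ᴳ H′ → G ⊕ H ≈ᴳ G′ ⊕ H′
⊕-cong e f u v = cong₂ _xor_ (e u v) (f u v)

-- Graphs as elements of a finite set

codes : ℕ → ℕ
codes n = (2 ^ n) ^ n

encode : ∀ {n} → Graph n → Fin (codes n)
encode G = funToFin λ u → funToFin λ v → Inverse.from Fin.2↔Bool (adj G u v)

-- The conjunction symmetrises, so every code yields a graph, and the codes cover all graphs up to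
-- `_≈ᴳ_`. Searches over graphs therefore require predicates that respect `_≈ᴳ_`.
decode : ∀ {n} → Fin (codes n) → Graph n
decode {n} c = graphOf (λ u v → raw u v ∧ raw v u) (λ u v → ∧-comm (raw u v) (raw v u))
  where
  raw : Fin n → Fin n → Bool
  raw u v = Inverse.to Fin.2↔Bool (finToFun {m = 2} (finToFun {m = 2 ^ n} c u) v)

decode-encode : ∀ {n} (G : Graph n) → decode (encode G) ≈ᴳ G
decode-encode {n} G u v with u Fin.≟ v
... | yes refl = sym (adj-irrefl G u)
... | no  _    = trans (cong₂ _∧_ (raw u v) (trans (raw v u) (adj-sym G v u))) (∧-idem _)
  where
  raw : ∀ u v → Inverse.to Fin.2↔Bool (finToFun {m = 2} (finToFun {m = 2 ^ n} (encode G) u) v) ≡ adj G u v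
  raw u v = trans
    (cong (Inverse.to Fin.2↔Bool) (trans
      (cong (λ c → finToFun {m = 2} {n} c v) (Fin.finToFun-funToFin {n} _ u))
      (Fin.finToFun-funToFin {n} _ v)))
    (Inverse.strictlyInverseˡ Fin.2↔Bool (adj G u v))

Adj-resp : ∀ {n} {G H : Graph n} → G ≈ᴳ H → ∀ {u v} → Adj G u v → Adj H u v
Adj-resp e {u} {v} = subst T (e u v)

∃-graph? : ∀ {n p} {P : Graph n → Set p} → (∀ {G H} → G ≈ᴳ H → P G → P H) →
  Decidable P → Dec (∃ P)
∃-graph? resp P? = map′ (λ (c , p) → decode c , p)
  (λ (G , p) → encode G , resp {G} {decode (encode G)} (≈ᴳ-sym {G = decode (encode G)} {G} (decode-encode G)) p) (Fin.any? (P? ∘ decode))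

leaves-cong : ∀ {n} {G H : Graph n} → G ≈ᴳ H → leaves G ≡ leaves H
leaves-cong e = tabulate-cong λ v →
  cong (λ s → does (Subset.∣ s ∣ ≟ 1)) (tabulate-cong (e v))

spanningTree? : ∀ {n} (G S : Graph n) → Dec (IsSpanningTree G S)
spanningTree? G S = (connected? S ×-dec acyclic? S) ×-dec
  map′ (λ h u v → h u v) (λ h u v → h u v)
    (Fin.all? λ u → Fin.all? λ v → T? (adj S u v) →-dec T? (adj G u v))

spanningTree-resp : ∀ {n} {G G′ S S′ : Graph n} → G ≈ᴳ G′ → S ≈ᴳ S′ →
  IsSpanningTree G S → IsSpanningTree G′ S′
spanningTree-resp {n} {G} {G′} {S} {S′} e f ((conn , acyc) , sub) =
  ( (λ u v → Star.map (Adj-resp {G = S} {S′} f) (conn u v))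
  , (λ { v vs (l , u , c) →
      acyc v vs (l , u , Linked.map (Adj-resp {G = S′} {S} (≈ᴳ-sym {G = S} {S′} f)) c) }) )
  , λ u v → Adj-resp {G = G} {G′} e ∘ sub u v ∘ Adj-resp {G = S′} {S} (≈ᴳ-sym {G = S} {S′} f)

𝓕-resp : ∀ {ℓ n} {G H : Graph n} → G ≈ᴳ H → 𝓕 ℓ n G → 𝓕 ℓ n H
𝓕-resp {G = G} {H} e (S , t , l) = S , spanningTree-resp {G = G} {H} {S} {S} e (λ _ _ → refl) t , l

𝓕? : ∀ ℓ n (G : Graph n) → Dec (𝓕 ℓ n G)
𝓕? ℓ n G = ∃-graph?
  (λ {S} {S′} e (t , l) →
    spanningTree-resp {G = G} {G} {S} {S′} (λ _ _ → refl) e t ,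
    trans (cong Subset.∣_∣ (sym (leaves-cong {G = S} {S′} e))) l)
  (λ S → spanningTree? G S ×-dec (Subset.∣ leaves S ∣ ≟ ℓ))

-- A spanning tree on at least two vertices has an edge, so G ⊕ H does too.
𝓕⇒≉ : ∀ {ℓ n} → 2 ≤ n → (G H : Graph n) → 𝓕 ℓ n (G ⊕ H) → ¬ G ≈ᴳ H
𝓕⇒≉ (s≤s (s≤s z≤n)) G H (S , ((conn , _) , sub) , _) G≈H
  with conn zero (suc zero)
... | e ◅ _ = subst T (trans (cong (_xor adj H _ _) (G≈H _ _)) (xor-same (adj H _ _))) (sub _ _ e)

-- An indexed form of good families, chosen because functions out of `Fin k` can be enumerated.
-- Distinctness of the graphs comes for free from `𝓕⇒≉` once there are two vertices.
IsCode : ∀ (ℓ : ℕ) {n k} → (Fin k → Graph n) → Set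
IsCode ℓ {n} f = ∀ i j → i ≢ j → 𝓕 ℓ n (f i ⊕ f j)

HasCode : ℕ → ℕ → ℕ → Set
HasCode ℓ n k = ∃[ f ] IsCode ℓ {n} {k} f

hasCode? : ∀ ℓ n k → Dec (HasCode ℓ n k)
hasCode? ℓ n k = map′ (λ (c , g) → decode ∘ finToFun c , g) from
  (Fin.any? λ c → Fin.all? λ i → Fin.all? λ j → ¬? (i Fin.≟ j) →-dec
    𝓕? ℓ n (decode (finToFun c i) ⊕ decode (finToFun c j)))
  where
  from : HasCode ℓ n k → ∃[ c ] IsCode ℓ {n} {k} (decode ∘ finToFun c)
  from (f , g) = funToFin (encode ∘ f) , λ i j i≢j →
    𝓕-resp {G = f i ⊕ f j} {decode (finToFun c i) ⊕ decode (finToFun c j)}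
      (⊕-cong {G = f i} {decode (finToFun c i)} {f j} {decode (finToFun c j)} (eq i) (eq j)) (g i j i≢j)
    where
    c = funToFin (encode ∘ f)
    eq : ∀ i → f i ≈ᴳ decode (finToFun c i)
    eq i u v = sym (trans
      (cong (λ c → adj (decode c) u v) (Fin.finToFun-funToFin (encode ∘ f) i))
      (decode-encode (f i) u v))

hasCode⇒≤ : ∀ {ℓ n} → 2 ≤ n → ∀ k → HasCode ℓ n k → k ≤ codes n
hasCode⇒≤ {n = n} 2≤n k (f , g) = Fin.injective⇒≤ encode∘f-injective
  where
  encode∘f-injective : injective (encode ∘ f)
  encode∘f-injective {i} {j} eq with i Fin.≟ j
  ... | yes i≡j = i≡j
  ... | no  i≢j = contradiction
    (λ u v → trans (sym (decode-encode (f i) u v))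
      (trans (cong (λ c → adj (decode c) u v) eq) (decode-encode (f j) u v)))
    (𝓕⇒≉ 2≤n (f i) (f j) (g i j i≢j))

maximum : ∀ {p} {P : Pred ℕ p} → Decidable P → ∀ b → (∀ k → P k → k ≤ b) →
  ∀ {m} → P m → ∃[ k ] P k × m ≤ k × (∀ j → P j → j ≤ k)
maximum P? b bound {m} pm with P? b
... | yes pb = b , pb , bound m pm , bound
maximum P? zero    bound {m} pm | no ¬p0 with bound m pm
... | z≤n = contradiction pm ¬p0
maximum {P = P} P? (suc b) bound {m} pm | no ¬pb = maximum P? b bound′ pm
  where
  bound′ : ∀ k → P k → k ≤ b
  bound′ k pk with m≤n⇒m<n∨m≡n (bound k pk)
  ... | inj₁ (s≤s k≤b) = k≤b
  ... | inj₂ refl      = contradiction pk ¬pb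

module _ {ℓ n : ℕ} (2≤n : 2 ≤ n) where
  open SetoidMembership (graphSetoid n) using (_∈_)

  code⇒family : ∀ {k} → HasCode ℓ n k →
    ∃[ 𝒢 ] IsFamily {n} 𝒢 × Good (𝓕 ℓ) 𝒢 × length 𝒢 ≡ k
  code⇒family (f , g) = List.tabulate f
    , AllPairs.tabulate⁺ (λ {i} {j} i≢j → 𝓕⇒≉ 2≤n (f i) (f j) (g i j i≢j))
    , (λ {G} {H} → good {G} {H}) , List.length-tabulate f
    where
    good : Good (𝓕 ℓ) (List.tabulate f)
    good {G} {H} G∈ H∈ G≉H
      with i , G≈ ← SetoidMembershipₚ.∈-tabulate⁻ (graphSetoid n) {f = f} {G} G∈
         | j , H≈ ← SetoidMembershipₚ.∈-tabulate⁻ (graphSetoid n) {f = f} {H} H∈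
      with i Fin.≟ j
    ... | yes refl = contradiction (λ u v → trans (G≈ u v) (sym (H≈ u v))) G≉H
    ... | no i≢j   = 𝓕-resp {G = f i ⊕ f j} {G ⊕ H}
      (λ u v → sym (⊕-cong {G = G} {f i} {H} {f j} G≈ H≈ u v)) (g i j i≢j)

  family⇒code : ∀ 𝒢 → IsFamily {n} 𝒢 → Good (𝓕 ℓ) 𝒢 → HasCode ℓ n (length 𝒢)
  family⇒code 𝒢 u good = lookup 𝒢 , λ i j i≢j →
    good {lookup 𝒢 i} {lookup 𝒢 j} (SetoidMembershipₚ.∈-lookup (graphSetoid n) 𝒢 i)
         (SetoidMembershipₚ.∈-lookup (graphSetoid n) 𝒢 j)
         (allPairs-lookup (λ {G} {H} G≉H → G≉H ∘ ≈ᴳ-sym {G = H} {G}) u i≢j)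

  -- Possible sizes of codes are decidable and bounded by the number of graph codes, so a largest
  -- one is found constructively; it is at least the size of the given code.
  code⇒M : ∀ {k} → HasCode ℓ n k → ∃[ m ] M[ 𝓕 ℓ , n ]≡ m × k ≤ m
  code⇒M c with m , max , k≤m , bound ← maximum (hasCode? ℓ n) (codes n) (hasCode⇒≤ 2≤n) c =
    m , (code⇒family max , λ 𝒢 u good → bound (length 𝒢) (family⇒code 𝒢 u (λ {G} {H} → good {G} {H}))) , k≤m

-- Counting leaves of a rooted tree

-- Replaces the recursively computed cardinality by an indexing with `Fin`, so that counting leaves
-- and neighbours becomes a comparison of injections.
enumerate : ∀ {n} (p : Fin n → Bool) → ∃[ g ] injective {A = Fin Subset.∣ tabulate p ∣} g
  × (∀ i → T (p (g i))) × (∀ v → T (p v) → ∃[ i ] g i ≡ v)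
enumerate {zero}  p = (λ ()) , (λ { {()} }) , (λ ()) , λ ()
enumerate {suc n} p with p zero in eq | enumerate (p ∘ suc)
... | false | g , inj , sound , complete = suc ∘ g , inj ∘ Fin.suc-injective , sound ,
  λ { zero t → contradiction (subst T eq t) id
    ; (suc v) t → map₂ (cong suc) (complete v t) }
... | true  | g , inj , sound , complete = g′ , g′-injective , sound′ ,
  λ { zero t → zero , refl ; (suc v) t → map suc (cong suc) (complete v t) }
  where
  g′ : Fin (suc _) → Fin (suc n)
  g′ zero    = zero
  g′ (suc i) = suc (g i)
  g′-injective : injective g′
  g′-injective {zero}  {zero}  _ = refl
  g′-injective {zero}  {suc j} ()
  g′-injective {suc i} {zero}  ()
  g′-injective {suc i} {suc j} e = cong suc (inj (Fin.suc-injective e))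
  sound′ : ∀ i → T (p (g′ i))
  sound′ zero    = subst T (sym eq) tt
  sound′ (suc i) = sound i

∣∣-≡ : ∀ {n k} (p : Fin n → Bool) (f : Fin k → Fin n) → injective f →
  (∀ i → T (p (f i))) → (∀ v → T (p v) → ∃[ i ] f i ≡ v) → Subset.∣ tabulate p ∣ ≡ k
∣∣-≡ p f f-inj f-sound f-complete with g , g-inj , g-sound , g-complete ← enumerate p =
  ≤-antisym
    (Fin.injective⇒≤ {f = λ i → f-complete (g i) (g-sound i) .proj₁}
      λ {i} {j} e → g-inj (trans (sym (f-complete (g i) _ .proj₂))
        (trans (cong f e) (f-complete (g j) _ .proj₂))))
    (Fin.injective⇒≤ {f = λ i → g-complete (f i) (f-sound i) .proj₁}
      λ {i} {j} e → f-inj (trans (sym (g-complete (f i) _ .proj₂))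
        (trans (cong g e) (g-complete (f j) _ .proj₂))))

∣∣-≢1 : ∀ {n} (p : Fin n → Bool) {u v} → T (p u) → T (p v) → u ≢ v → Subset.∣ tabulate p ∣ ≢ 1
∣∣-≢1 p {u} {v} pu pv u≢v eq with g , _ , _ , complete ← enumerate p
  with i , gi≡u ← complete u pu | j , gj≡v ← complete v pv =
  u≢v (trans (sym gi≡u) (trans (cong g (fin1 eq i j)) gj≡v))
  where
  fin1 : ∀ {m} → m ≡ 1 → (i j : Fin m) → i ≡ j
  fin1 refl zero zero = refl

leaf : ∀ {n} (G : Graph n) {u v} → Adj G u v → (∀ {w} → Adj G u w → w ≡ v) → degree G u ≡ 1
leaf G {u} {v} e unique = ∣∣-≡ (adj G u) (λ (_ : Fin 1) → v)
  (λ { {zero} {zero} _ → refl }) (λ _ → e) (λ w f → zero , sym (unique f))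

-- The rank is a potential that rises towards the root. It yields connectedness, by climbing, and
-- acyclicity, since a walk that never backtracks cannot rise again after falling.
module RootedTree {n : ℕ} (r : Fin n) (par : Fin n → Fin n) (rank : Fin n → ℕ)
  (rank-par : ∀ {u} → u ≢ r → rank u < rank (par u))
  (rank<n : ∀ u → rank u < n) where

  Up : Fin n → Fin n → Set
  Up u v = u ≢ r × par u ≡ v

  edge? : ∀ u v → Dec (Up u v ⊎ Up v u)
  edge? u v = up? u v ⊎-dec up? v u
    where
    up? : ∀ u v → Dec (Up u v)
    up? u v = ¬? (u Fin.≟ r) ×-dec (par u Fin.≟ v)

  tree : Graph n
  tree = graphOf (λ u v → isYes (edge? u v)) λ u v → isYes-swap (edge? u v) (edge? v u)
    where
    isYes-swap : ∀ {A B : Set} (d : Dec (A ⊎ B)) (e : Dec (B ⊎ A)) → isYes d ≡ isYes e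
    isYes-swap (yes _) (yes _) = refl
    isYes-swap (yes p) (no ¬q) = contradiction (swap p) ¬q
    isYes-swap (no ¬p) (yes q) = contradiction (swap q) ¬p
    isYes-swap (no _)  (no _)  = refl

  up-< : ∀ {u v} → Up u v → rank u < rank v
  up-< (u≢r , refl) = rank-par u≢r

  adj⇒edge : ∀ {u v} → Adj tree u v → Up u v ⊎ Up v u
  adj⇒edge {u} {v} e with u Fin.≟ v
  ... | no _ = toWitness {a? = edge? u v} e

  edge⇒adj : ∀ {u v} → Up u v ⊎ Up v u → Adj tree u v
  edge⇒adj {u} {v} e with u Fin.≟ v
  ... | yes refl = contradiction refl ([ <⇒≢ ∘ up-< , <⇒≢ ∘ up-< ]′ e)
  ... | no _     = fromWitness {a? = edge? u v} e

  -- `k` is fuel: each step to the parent raises the rank, which stays below `n`.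
  reach-root : ∀ k u → n ≤ rank u + k → Star (Adj tree) u r
  reach-root k u n≤ with u Fin.≟ r
  ... | yes refl = ε
  reach-root zero    u n≤ | no u≢r =
    contradiction (subst (n ≤_) (+-identityʳ _) n≤) (<⇒≱ (rank<n u))
  reach-root (suc k) u n≤ | no u≢r = edge⇒adj (inj₁ (u≢r , refl)) ◅
    reach-root k (par u) (≤-trans n≤ (≤-trans (≤-reflexive (+-suc (rank u) k))
      (+-monoˡ-≤ k (rank-par u≢r))))

  connected : Connected tree
  connected u v = reach-root n u (m≤n+m n _) Star.◅◅
    Star.reverse (λ {x} {y} → subst T (adj-sym tree x y)) (reach-root n v (m≤n+m n _))

  NonBacktracking : List (Fin n) → Set
  NonBacktracking (x ∷ y ∷ z ∷ zs) = x ≢ z × NonBacktracking (y ∷ z ∷ zs)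
  NonBacktracking _                = ⊤

  -- A walk that does not backtrack keeps descending once it has descended.
  descend : ∀ {q x v} ws → Up x q → Linked (Adj tree) (x ∷ (ws ∷ʳ v)) →
    NonBacktracking (q ∷ x ∷ (ws ∷ʳ v)) → rank v < rank x × ∃[ w ] w ∈ x ∷ ws × Up v w
  descend [] (_ , px≡q) (e ∷ _) (q≢v , _) with adj⇒edge e
  ... | inj₁ (_ , px≡v) = contradiction (trans (sym px≡q) px≡v) q≢v
  ... | inj₂ d          = up-< d , _ , here refl , d
  descend (y ∷ ws) (_ , px≡q) (e ∷ es) (q≢y , nb) with adj⇒edge e
  ... | inj₁ (_ , px≡y) = contradiction (trans (sym px≡q) px≡y) q≢y
  ... | inj₂ d with lt , w , w∈ , up ← descend ws d es nb =
    <-trans lt (up-< d) , w , there w∈ , up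

  -- The walk rises up to its first descent, if there is one. From then on it falls, so it enters
  -- `v` from the parent of `v`.
  climb : ∀ {x v} ws → Linked (Adj tree) (x ∷ (ws ∷ʳ v)) → NonBacktracking (x ∷ (ws ∷ʳ v)) →
    rank x < rank v ⊎ ∃[ w ] w ∈ x ∷ ws × Up v w
  climb [] (e ∷ _) _ with adj⇒edge e
  ... | inj₁ up = inj₁ (up-< up)
  ... | inj₂ d  = inj₂ (_ , here refl , d)
  climb (y ∷ ws) (e ∷ es) nb with adj⇒edge e
  ... | inj₂ d with _ , w , w∈ , up ← descend ws d es nb = inj₂ (w , there w∈ , up)
  climb (y ∷ ws) (e ∷ es) nb | inj₁ up with climb ws es (tail ws nb)
    where
    tail : ∀ {x y v} ws → NonBacktracking (x ∷ y ∷ (ws ∷ʳ v)) → NonBacktracking (y ∷ (ws ∷ʳ v))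
    tail []      (_ , nb) = nb
    tail (_ ∷ _) (_ , nb) = nb
  ... | inj₁ lt              = inj₁ (<-trans (up-< up) lt)
  ... | inj₂ (w , w∈ , up′) = inj₂ (w , there w∈ , up′)

  unique⇒nonBacktracking : ∀ ws {v} → AllPairs _≢_ ws → All (v ≢_) ws → NonBacktracking (ws ∷ʳ v)
  unique⇒nonBacktracking [] u v∉ = _
  unique⇒nonBacktracking (x ∷ []) u v∉ = _
  unique⇒nonBacktracking (x ∷ y ∷ []) u (v≢x ∷ _) = v≢x ∘ sym , _
  unique⇒nonBacktracking (x ∷ y ∷ z ∷ ws) ((_ ∷ x≢z ∷ _) ∷ u) (_ ∷ v∉) =
    x≢z , unique⇒nonBacktracking (y ∷ z ∷ ws) u v∉

  -- A cycle that leaves `v` downwards keeps falling and cannot come back. One that leaves upwards,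
  -- to the parent `y`, either only rises, which the ranks forbid, or re-enters `v` from its parent,
  -- which would be a second visit to `y`.
  no-cycle : ∀ {v y z ws} → v ≢ z → All (y ≢_) (z ∷ ws) →
    Linked (Adj tree) (v ∷ y ∷ z ∷ (ws ∷ʳ v)) →
    NonBacktracking (y ∷ z ∷ (ws ∷ʳ v)) → NonBacktracking (z ∷ (ws ∷ʳ v)) → ⊥
  no-cycle {ws = ws} v≢z y∉ (e ∷ es@(e′ ∷ es′)) nb nb′ with adj⇒edge e | adj⇒edge e′
  ... | inj₂ d | _ = <-asym (up-< d) (descend (_ ∷ ws) d es (v≢z , nb) .proj₁)
  ... | inj₁ (_ , pv≡y) | inj₂ d with _ , w , w∈ , _ , pv≡w ← descend ws d es′ nb =
    All.lookup y∉ w∈ (trans (sym pv≡y) pv≡w)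
  ... | inj₁ up@(_ , pv≡y) | inj₁ up′ with climb ws es′ nb′
  ...   | inj₁ lt = <-asym (<-trans (up-< up) (up-< up′)) lt
  ...   | inj₂ (w , w∈ , _ , pv≡w) = All.lookup y∉ w∈ (trans (sym pv≡y) pv≡w)

  acyclic : Acyclic tree
  acyclic v (_ ∷ []) (s≤s () , _)
  acyclic v (y ∷ z ∷ ws) (_ , (v∉@(_ ∷ v≢z ∷ _) ∷ u@(y∉ ∷ u′)) , es) =
    no-cycle {ws = ws} v≢z y∉ es (unique⇒nonBacktracking (y ∷ z ∷ ws) u v∉)
      (unique⇒nonBacktracking (z ∷ ws) u′ (All.tail v∉))

  childless-leaf : ∀ {u} → u ≢ r → (∀ {v} → ¬ Up v u) → degree tree u ≡ 1
  childless-leaf {u} u≢r childless = leaf tree {u} {par u} (edge⇒adj (inj₁ (u≢r , refl)))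
    λ {w} e → [ sym ∘ proj₂ , (λ d → contradiction d childless) ]′ (adj⇒edge {u} {w} e)

  root-leaf : ∀ {u} → Up u r → (∀ {v} → Up v r → v ≡ u) → degree tree r ≡ 1
  root-leaf {u} up unique = leaf tree {r} {u} (edge⇒adj (inj₂ up))
    λ {w} e → [ (λ (r≢r , _) → contradiction refl r≢r) , unique ]′ (adj⇒edge {r} {w} e)

  parent-nonleaf : ∀ {u v} → u ≢ r → Up v u → degree tree u ≢ 1
  parent-nonleaf {u} {v} u≢r up = ∣∣-≢1 (adj tree u) {par u} {v}
    (edge⇒adj (inj₁ (u≢r , refl))) (edge⇒adj (inj₂ up))
    λ pu≡v → <⇒≢ (<-trans (up-< up) (rank-par u≢r)) (cong rank (sym pu≡v))

-- Spanning trees from a Hamiltonian path and chords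

-- The last position has no successor and gets itself as a default value.
next : ∀ {n} → Fin n → Fin n
next {suc zero}    zero    = zero
next {suc (suc n)} zero    = suc zero
next {suc (suc n)} (suc k) = suc (next k)

toℕ-next : ∀ {n} (k : Fin n) → suc (toℕ k) < n → toℕ (next k) ≡ suc (toℕ k)
toℕ-next {suc zero}    zero    (s≤s ())
toℕ-next {suc (suc n)} zero    _        = refl
toℕ-next {suc (suc n)} (suc k) (s≤s lt) = cong suc (toℕ-next k lt)

T-does : ∀ {a} {A : Set a} (d : Dec A) → T (does d) → A
T-does (yes a) _ = a

-- The position k gets the parent k + 1, except that a i gets the parent b i. As no b j is a i + 1,
-- the leaves are the two ends of the path and the positions a i + 1.
module PathTree {M t : ℕ} (at pos : Fin (2 + M) → Fin (2 + M))
  (at-pos : ∀ v → at (pos v) ≡ v) (pos-at : ∀ k → pos (at k) ≡ k)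
  (a b : Fin t → Fin (2 + M)) (a-injective : injective a)
  (1+a<b : ∀ i → suc (toℕ (a i)) < toℕ (b i)) (b<1+M : ∀ i → toℕ (b i) < suc M)
  (1+a≢b : ∀ i j → suc (toℕ (a i)) ≢ toℕ (b j)) where

  n = 2 + M

  Pos : Set
  Pos = Fin n

  at-injective : injective at
  at-injective {k} {l} eq = trans (sym (pos-at k)) (trans (cong pos eq) (pos-at l))

  1+a<1+M : ∀ i → suc (toℕ (a i)) < suc M
  1+a<1+M i = <-trans (1+a<b i) (b<1+M i)

  toℕ-next-a : ∀ i → toℕ (next (a i)) ≡ suc (toℕ (a i))
  toℕ-next-a i = toℕ-next (a i) (m<n⇒m<1+n (1+a<1+M i))

  parent : Pos → Pos
  parent k with Fin.any? (λ i → a i Fin.≟ k)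
  ... | yes (i , _) = b i
  ... | no  _       = next k

  parent-cases : ∀ k → (∃[ i ] a i ≡ k × parent k ≡ b i) ⊎ ((∀ i → a i ≢ k) × parent k ≡ next k)
  parent-cases k with Fin.any? (λ i → a i Fin.≟ k)
  ... | yes (i , eq) = inj₁ (i , eq , refl)
  ... | no  ∄        = inj₂ ((λ i eq → ∄ (i , eq)) , refl)

  parent-< : ∀ k → toℕ k < suc M → toℕ k < toℕ (parent k)
  parent-< k k<1+M with parent-cases k
  ... | inj₁ (i , refl , eq) rewrite eq = <-trans (n<1+n _) (1+a<b i)
  ... | inj₂ (_ , eq)        rewrite eq = ≤-reflexive (sym (toℕ-next k (s≤s k<1+M)))

  root : Pos
  root = at (fromℕ (suc M))

  par : Pos → Pos
  par u = at (parent (pos u))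

  pos-par : ∀ u → pos (par u) ≡ parent (pos u)
  pos-par u = pos-at (parent (pos u))

  nonroot-< : ∀ {u} → u ≢ root → toℕ (pos u) < suc M
  nonroot-< {u} u≢r = ≤∧≢⇒< (Fin.toℕ≤pred[n] (pos u)) λ eq → u≢r (trans (sym (at-pos u))
    (cong at (Fin.toℕ-injective (trans eq (sym (Fin.toℕ-fromℕ (suc M)))))))

  <-nonroot : ∀ k → toℕ k < suc M → at k ≢ root
  <-nonroot k k<1+M eq = <⇒≢ k<1+M (trans (cong toℕ (at-injective eq)) (Fin.toℕ-fromℕ (suc M)))

  open RootedTree root par (toℕ ∘ pos)
    (λ {u} u≢r → subst (toℕ (pos u) <_) (cong toℕ (sym (pos-par u))) (parent-< (pos u) (nonroot-< u≢r)))
    (Fin.toℕ<n ∘ pos)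

  up-at : ∀ k → toℕ k < suc M → Up (at k) (at (parent k))
  up-at k k<1+M = <-nonroot k k<1+M , cong (at ∘ parent) (pos-at k)

  up-parent : ∀ {u k} → Up u (at k) → parent (pos u) ≡ k
  up-parent (_ , eq) = at-injective eq

  ends : Fin (2 + t) → Pos
  ends zero          = zero
  ends (suc zero)    = fromℕ (suc M)
  ends (suc (suc i)) = next (a i)

  ends-injective : injective ends
  ends-injective {zero} {zero} _ = refl
  ends-injective {zero} {suc (suc j)} eq = contradiction (trans (cong toℕ eq) (toℕ-next-a j)) 0≢1+n
  ends-injective {suc zero} {suc zero} _ = refl
  ends-injective {suc zero} {suc (suc j)} eq = contradiction
    (trans (sym (toℕ-next-a j)) (trans (cong toℕ (sym eq)) (Fin.toℕ-fromℕ (suc M)))) (<⇒≢ (1+a<1+M j))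
  ends-injective {suc (suc i)} {zero} eq = contradiction (trans (cong toℕ (sym eq)) (toℕ-next-a i)) 0≢1+n
  ends-injective {suc (suc i)} {suc zero} eq = contradiction
    (trans (sym (toℕ-next-a i)) (trans (cong toℕ eq) (Fin.toℕ-fromℕ (suc M)))) (<⇒≢ (1+a<1+M i))
  ends-injective {suc (suc i)} {suc (suc j)} eq = cong (λ k → Fin.suc (suc k)) (a-injective (Fin.toℕ-injective
    (suc-injective (trans (sym (toℕ-next-a i)) (trans (cong toℕ eq) (toℕ-next-a j))))))

  penultimate : Pos
  penultimate = inject₁ (fromℕ M)

  toℕ-penultimate : toℕ penultimate ≡ M
  toℕ-penultimate = trans (Fin.toℕ-inject₁ (fromℕ M)) (Fin.toℕ-fromℕ M)

  parent-penultimate : parent penultimate ≡ fromℕ (suc M)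
  parent-penultimate with parent-cases penultimate
  ... | inj₁ (i , eq , _) = contradiction
    (cong suc (trans (cong toℕ eq) toℕ-penultimate)) (<⇒≢ (1+a<1+M i))
  ... | inj₂ (_ , eq) = trans eq (Fin.toℕ-injective (trans
    (toℕ-next penultimate (s≤s (s≤s (≤-reflexive toℕ-penultimate))))
    (trans (cong suc toℕ-penultimate) (sym (Fin.toℕ-fromℕ (suc M))))))

  -- No chord ends at the last position, so the root keeps the penultimate position as its only
  -- child and is itself a leaf.
  parent≡last : ∀ {k} → toℕ k < suc M → parent k ≡ fromℕ (suc M) → k ≡ penultimate
  parent≡last {k} k<1+M eq with parent-cases k
  ... | inj₁ (i , _ , eq′) = contradiction
    (trans (cong toℕ (trans (sym eq′) eq)) (Fin.toℕ-fromℕ (suc M))) (<⇒≢ (b<1+M i))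
  ... | inj₂ (_ , eq′) = Fin.toℕ-injective (trans (suc-injective (trans
    (sym (toℕ-next k (s≤s k<1+M))) (trans (cong toℕ (trans (sym eq′) eq)) (Fin.toℕ-fromℕ (suc M)))))
    (sym toℕ-penultimate))

  ends-leaf : ∀ i → degree tree (at (ends i)) ≡ 1
  ends-leaf zero = childless-leaf (<-nonroot zero z<s)
    λ {v} d → n≮0 (subst (toℕ (pos v) <_) (cong toℕ (pos-at zero)) (up-< d))
  ends-leaf (suc zero) = root-leaf {at penultimate}
    (subst (λ k → Up (at penultimate) (at k)) parent-penultimate
      (up-at penultimate (s≤s (≤-reflexive toℕ-penultimate))))
    λ {v} d → trans (sym (at-pos v)) (cong at (parent≡last (nonroot-< (proj₁ d)) (up-parent d)))
  ends-leaf (suc (suc i)) = childless-leaf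
    (<-nonroot (next (a i)) (subst (_< suc M) (sym (toℕ-next-a i)) (1+a<1+M i)))
    λ {v} d → childless v d
    where
    childless : ∀ v → ¬ Up v (at (next (a i)))
    childless v d with parent-cases (pos v)
    ... | inj₁ (j , _ , eq) = 1+a≢b i j (trans (sym (toℕ-next-a i))
      (cong toℕ (trans (sym (up-parent d)) eq)))
    ... | inj₂ (unchosen , eq) = unchosen i (Fin.toℕ-injective (suc-injective (trans
      (sym (toℕ-next-a i)) (trans (cong toℕ (trans (sym (up-parent d)) eq))
        (toℕ-next (pos v) (s≤s (nonroot-< (proj₁ d))))))))

  -- A position away from the ends keeps its predecessor on the path as a child and has a parent
  -- too, so its degree is not 1.
  leaf-end : ∀ v → degree tree v ≡ 1 → ∃[ i ] at (ends i) ≡ v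
  leaf-end v deg = map₂ (λ eq → trans (cong at eq) (at-pos v)) (position (pos v) refl)
    where
    position : ∀ k → pos v ≡ k → ∃[ i ] ends i ≡ k
    position zero    _ = zero , refl
    position (suc j) eq with toℕ j ≟ M | Fin.any? (λ i → a i Fin.≟ inject₁ j)
    ... | yes j≡M | _ = suc zero , cong suc (Fin.toℕ-injective (trans (Fin.toℕ-fromℕ M) (sym j≡M)))
    ... | no  j≢M | yes (i , a≡) = suc (suc i) , Fin.toℕ-injective (trans (toℕ-next-a i)
      (cong suc (trans (cong toℕ a≡) (Fin.toℕ-inject₁ j))))
    ... | no  j≢M | no ∄ = contradiction deg (parent-nonleaf v≢r child)
      where
      j<M : toℕ j < M
      j<M = ≤∧≢⇒< (Fin.toℕ≤pred[n] j) j≢M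
      v≡at : v ≡ at (suc j)
      v≡at = trans (sym (at-pos v)) (cong at eq)
      v≢r : v ≢ root
      v≢r = <-nonroot (suc j) (s≤s j<M) ∘ trans (sym v≡at)
      j′<1+M : toℕ (inject₁ j) < suc M
      j′<1+M = subst (_< suc M) (sym (Fin.toℕ-inject₁ j)) (m<n⇒m<1+n j<M)
      parent≡ : parent (inject₁ j) ≡ suc j
      parent≡ with parent-cases (inject₁ j)
      ... | inj₁ (i , a≡ , _) = contradiction (i , a≡) ∄
      ... | inj₂ (_ , p≡)     = trans p≡ (Fin.toℕ-injective
        (trans (toℕ-next (inject₁ j) (s≤s j′<1+M)) (cong suc (Fin.toℕ-inject₁ j))))
      child : Up (at (inject₁ j)) v
      child = subst (Up _) (trans (cong at parent≡) (sym v≡at)) (up-at (inject₁ j) j′<1+M)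

  ∣leaves∣ : Subset.∣ leaves tree ∣ ≡ 2 + t
  ∣leaves∣ = ∣∣-≡ (λ v → does (degree tree v ≟ 1)) (at ∘ ends) (ends-injective ∘ at-injective)
    (λ i → subst T (sym (dec-true (degree tree (at (ends i)) ≟ 1) (ends-leaf i))) tt)
    (λ v d → leaf-end v (T-does (degree tree v ≟ 1) d))

  spanning : (H : Graph n) → (∀ k → toℕ k < suc M → Adj H (at k) (at (next k))) →
    (∀ i → Adj H (at (a i)) (at (b i))) → 𝓕 (2 + t) n H
  spanning H path chords = tree , ((connected , acyclic) , sub) , ∣leaves∣
    where
    up⇒adj : ∀ {u v} → Up u v → Adj H u v
    up⇒adj {u} {v} (u≢r , par≡v) with parent-cases (pos u)
    ... | inj₁ (i , a≡ , p≡) = subst₂ (Adj H) (trans (cong at a≡) (at-pos u))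
      (trans (cong at (sym p≡)) par≡v) (chords i)
    ... | inj₂ (_ , p≡) = subst₂ (Adj H) (at-pos u)
      (trans (cong at (sym p≡)) par≡v) (path (pos u) (nonroot-< u≢r))
    sub : ∀ u v → Adj tree u v → Adj H u v
    sub u v e = [ up⇒adj , subst T (adj-sym H v u) ∘ up⇒adj ]′ (adj⇒edge {u} {v} e)

-- Greedy choice of compatible chords from a matching

filter-≢-length : ∀ {e} {E : Set e} (f : E → ℕ) k {es} → AllPairs (λ x y → f x ≢ f y) es →
  length es ≤ suc (length (filter (λ x → ¬? (f x ≟ k)) es))
filter-≢-length f k [] = z≤n
filter-≢-length {E = E} f k {x ∷ es} (x≢ ∷ u) with f x ≟ k
... | no fx≢k = ≤-trans (s≤s (filter-≢-length f k u))
  (s≤s (≤-reflexive (cong length (sym (List.filter-accept (λ y → ¬? (f y ≟ k)) {xs = es} fx≢k)))))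
... | yes refl = s≤s (≤-reflexive (cong length (sym (trans
  (List.filter-reject P? {xs = es} (contradiction refl))
  (List.filter-all P? (All.map (λ fx≢fy → fx≢fy ∘ sym) x≢))))))
  where P? = λ y → ¬? (f y ≟ f x)

module _ {e : Level} {E : Set e} (a b : E → ℕ) where

  Disjoint NonConflicting : Rel E _
  Disjoint       x y = a x ≢ a y × b x ≢ b y
  NonConflicting x y = a x ≢ a y × suc (a x) ≢ b y × suc (a y) ≢ b x

  -- An edge conflicts with at most two others, so a greedy choice keeps a third.
  select : ∀ {p} {P : Pred E p} t es → AllPairs Disjoint es → All P es → 3 * t ≤ length es →
    ∃[ fs ] length fs ≡ t × AllPairs NonConflicting fs × All P fs
  select zero    es       u p l = [] , refl , [] , []
  select (suc t) (x ∷ es) (d ∷ u) (px ∷ p) l =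
    let fs , len , nc , q = select t (filter F? (filter G? es))
          (AllPairs.filter⁺ F? (AllPairs.filter⁺ G? u))
          (All.zip (All.filter⁺ F? (All.filter⁺ G? (All.zip (d , p))) ,
            All.zip (All.all-filter F? (filter G? es) , All.filter⁺ F? (All.all-filter G? es))))
          bound
    in x ∷ fs , cong suc len ,
       All.map (λ (((ax≢ , _) , _) , f , g) → ax≢ , (λ eq → g (sym eq)) , f) q ∷ nc ,
       px ∷ All.map (λ ((_ , py) , _) → py) q
    where
    -- `F?` discards the edge that starts just before the right end of `x`, `G?` the one that ends
    -- just after its left end. Left ends are pairwise distinct, and so are right ends, so each
    -- costs at most one edge.
    F? = λ y → ¬? (suc (a y) ≟ b x)
    G? = λ y → ¬? (b y ≟ suc (a x))
    open ≤-Reasoning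
    bound : 3 * t ≤ length (filter F? (filter G? es))
    bound = s≤s⁻¹ (s≤s⁻¹ (s≤s⁻¹ (begin
      3 + 3 * t                                    ≡⟨ *-suc 3 t ⟨
      3 * suc t                                    ≤⟨ l ⟩
      1 + length es                                ≤⟨ s≤s (filter-≢-length b (suc (a x)) (AllPairs.map proj₂ u)) ⟩
      2 + length (filter G? es)                    ≤⟨ s≤s (s≤s (filter-≢-length (suc ∘ a) (b x)
        (AllPairs.map (_∘ suc-injective) (AllPairs.map proj₁ (AllPairs.filter⁺ G? u))))) ⟩
      3 + length (filter F? (filter G? es))        ∎)))
  select (suc t) [] _ _ ()

-- Each matching edge is oriented forwards along the path. The extra one in `suc (3 * t)` pays for
-- an edge that might end at the last position, which has to stay a leaf; the remaining `3 * t`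
-- allow `t` greedy choices.
pathWithMatching⇒𝓕 : ∀ {M m t} (H : Graph (2 + M)) (at pos : Fin (2 + M) → Fin (2 + M)) →
  (∀ v → at (pos v) ≡ v) → (∀ k → pos (at k) ≡ k) →
  (∀ k → toℕ k < suc M → Adj H (at k) (at (next k))) →
  (e : Fin m → Bool → Fin (2 + M)) →
  (∀ i → Adj H (e i false) (e i true)) →
  (∀ i j s s′ → e i s ≡ e j s′ → i ≡ j) →
  (∀ i s → toℕ (pos (e i (not s))) ≢ suc (toℕ (pos (e i s)))) →
  suc (3 * t) ≤ m → 𝓕 (2 + t) (2 + M) H
pathWithMatching⇒𝓕 {M} {m} {t} H at pos at-pos pos-at path e adjacent disjoint nonconsecutive bound
  = result (select (toℕ ∘ a) (toℕ ∘ b) {P = λ i → toℕ (b i) < suc M} t (filter B? (List.allFin m))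
      (AllPairs.filter⁺ B? all-disjoint) (All.map (λ {i} → ≤∧≢⇒< (Fin.toℕ≤pred[n] (b i))) (All.all-filter B? (List.allFin m)))
      (s≤s⁻¹ (≤-trans bound (≤-trans (≤-reflexive (sym (List.length-tabulate {n = m} id)))
        (filter-≢-length (toℕ ∘ b) (suc M) (AllPairs.map proj₂ all-disjoint))))))
  where
  module _ (i : Fin m) where
    orientation : ∃[ s ] toℕ (pos (e i s)) < toℕ (pos (e i (not s)))
    orientation with <-cmp (toℕ (pos (e i false))) (toℕ (pos (e i true)))
    ... | tri< lt _ _ = false , lt
    ... | tri> _ _ gt = true , gt
    ... | tri≈ _ eq _ = contradiction
      (trans (sym (at-pos _)) (trans (cong at (Fin.toℕ-injective eq)) (at-pos _))) e-irrefl
      where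
      e-irrefl : e i false ≢ e i true
      e-irrefl eq = subst T (trans (cong (adj H _) (sym eq)) (adj-irrefl H _)) (adjacent i)

    s = orientation .proj₁
    a b : Fin (2 + M)
    a = pos (e i s)
    b = pos (e i (not s))

    1+a<b : suc (toℕ a) < toℕ b
    1+a<b = ≤∧≢⇒< (orientation .proj₂) (nonconsecutive i s ∘ sym)

    chord : Adj H (at a) (at b)
    chord rewrite at-pos (e i s) | at-pos (e i (not s)) with s
    ... | false = adjacent i
    ... | true  = subst T (adj-sym H _ _) (adjacent i)

  B? = λ i → ¬? (toℕ (b i) ≟ suc M)

  pos-injective : injective pos
  pos-injective {u} {v} eq = trans (sym (at-pos u)) (trans (cong at eq) (at-pos v))

  all-disjoint : AllPairs (Disjoint (toℕ ∘ a) (toℕ ∘ b)) (List.allFin m)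
  all-disjoint = AllPairs.tabulate⁺ λ i≢j →
    i≢j ∘ disjoint _ _ _ _ ∘ pos-injective ∘ Fin.toℕ-injective ,
    i≢j ∘ disjoint _ _ _ _ ∘ pos-injective ∘ Fin.toℕ-injective

  result : (∃[ fs ] length fs ≡ t × AllPairs (NonConflicting (toℕ ∘ a) (toℕ ∘ b)) fs ×
    All (λ i → toℕ (b i) < suc M) fs) → 𝓕 (2 + t) (2 + M) H
  result (fs , refl , nc , b<1+M) = PathTree.spanning at pos at-pos pos-at
    (a ∘ lookup fs) (b ∘ lookup fs) a-injective (1+a<b ∘ lookup fs)
    (λ k → All.lookup b<1+M (∈-lookup k)) 1+a≢b H path (chord ∘ lookup fs)
    where
    nonConflicting : ∀ {k l} → k ≢ l → NonConflicting (toℕ ∘ a) (toℕ ∘ b) (lookup fs k) (lookup fs l)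
    nonConflicting = allPairs-lookup (λ (p , q , r) → p ∘ sym , r , q) nc
    a-injective : injective (a ∘ lookup fs)
    a-injective {k} {l} eq with k Fin.≟ l
    ... | yes k≡l = k≡l
    ... | no  k≢l = contradiction (cong toℕ eq) (nonConflicting k≢l .proj₁)
    1+a≢b : ∀ k l → suc (toℕ (a (lookup fs k))) ≢ toℕ (b (lookup fs l))
    1+a≢b k l with k Fin.≟ l
    ... | yes refl = <⇒≢ (1+a<b (lookup fs k))
    ... | no  k≢l  = nonConflicting k≢l .proj₂ .proj₁

-- The family given by a perfect colouring

sum-zero : ∀ {n} (f : Fin n → Bool) → (∀ i → f i ≡ false) → sum f ≡ false
sum-zero {n} f f≡0 = trans (sum-cong-≗ f≡0) (sum-replicate-zero n)

sum-single : ∀ {n} (f : Fin n → Bool) i → (∀ k → k ≢ i → f k ≡ false) → sum f ≡ f i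
sum-single {suc n} f i f≡0 = trans (sum-remove {i = i} f) (trans
  (cong (f i xor_) (sum-zero (removeAt f i) λ k → f≡0 _ (Fin.punchInᵢ≢i i k)))
  (Bool.xor-identityʳ (f i)))

sum-pair : ∀ {n} (f : Fin n → Bool) {i j} → i ≢ j →
  (∀ k → k ≢ i → k ≢ j → f k ≡ false) → sum f ≡ f i xor f j
sum-pair {suc n} f {i} {j} i≢j f≡0 = trans (sum-remove {i = i} f) (cong (f i xor_) (trans
  (sum-single (removeAt f i) (punchOut i≢j) λ k k≢ → f≡0 _ (Fin.punchInᵢ≢i i k)
    λ eq → k≢ (Fin.punchIn-injective i _ _ (trans eq (sym (Fin.punchIn-punchOut i≢j)))))
  (cong f (Fin.punchIn-punchOut i≢j))))

xor-≢ : ∀ {x y} → x ≢ y → x xor y ≡ true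
xor-≢ {x} {y} x≢y = trans (cong (_xor y) (Bool.¬-not x≢y)) (Bool.xor-inverseˡ y)

-- A lone true entry would make the sum true.
even-weight-partner : ∀ {n} (f : Fin n → Bool) → sum f ≡ false → ∀ i → f i ≡ true →
  ∃[ j ] j ≢ i × f j ≡ true
even-weight-partner f even i fi with Fin.any? (λ j → ¬? (j Fin.≟ i) ×-dec (f j Bool.≟ true))
... | yes found = found
... | no  none  = contradiction (trans (sym fi) (trans (sym (sum-single f i alone)) even)) λ ()
  where
  alone : ∀ k → k ≢ i → f k ≡ false
  alone k k≢i = Bool.¬-not λ fk → none (k , k≢i , fk)

-- Binary digits, alternation and pigeonhole

bit : ℕ → ℕ → Bool
bit k zero    = does (k % 2 ≟ 0)
bit k (suc b) = bit (k / 2) b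

separating-bit : ∀ L {k l} → k < 2 ^ L → l < 2 ^ L → k ≢ l → ∃[ b ] b < L × bit k b ≢ bit l b
separating-bit zero {zero} {zero} _ _ k≢l = contradiction refl k≢l
separating-bit zero {suc k} (s≤s ())
separating-bit zero {zero} {suc l} _ (s≤s ())
separating-bit (suc L) {k} {l} k< l< k≢l with k / 2 ≟ l / 2
... | no k/2≢l/2 = map suc (map₁ s≤s) (separating-bit L
  (m<n*o⇒m/o<n (subst (k <_) (*-comm 2 (2 ^ L)) k<))
  (m<n*o⇒m/o<n (subst (l <_) (*-comm 2 (2 ^ L)) l<)) k/2≢l/2)
... | yes eq = 0 , z<s , differ (k % 2) (l % 2) (m%n<n k 2) (m%n<n l 2) λ r≡ → k≢l (trans
  (m≡m%n+[m/n]*n k 2) (trans (cong₂ (λ r q → r + q * 2) r≡ eq) (sym (m≡m%n+[m/n]*n l 2))))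
  where
  differ : ∀ r s → r < 2 → s < 2 → r ≢ s → does (r ≟ 0) ≢ does (s ≟ 0)
  differ 0 0 _ _ r≢s = contradiction refl r≢s
  differ 0 1 _ _ _ ()
  differ 1 0 _ _ _ ()
  differ 1 1 _ _ r≢s = contradiction refl r≢s
  differ (suc (suc _)) _ (s≤s (s≤s ()))
  differ 0 (suc (suc _)) _ (s≤s (s≤s ()))
  differ 1 (suc (suc _)) _ (s≤s (s≤s ()))

bitℕ : Bool → ℕ
bitℕ false = 0
bitℕ true  = 1

[bit+k*2]/2 : ∀ s k → (bitℕ s + k * 2) / 2 ≡ k
[bit+k*2]/2 s k = trans (+-distrib-/-∣ʳ (bitℕ s) (divides-refl k))
  (trans (cong (_+ k * 2 / 2) (small s)) (m*n/n≡m k 2))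
  where
  small : ∀ s → bitℕ s / 2 ≡ 0
  small false = refl
  small true  = refl

bit+k*2≤ : ∀ s k → bitℕ s + k * 2 ≤ suc (k * 2)
bit+k*2≤ false k = n≤1+n _
bit+k*2≤ true  k = ≤-refl

alternate : ∀ {a} {A : Set a} → A → A → ℕ → A
alternate a b zero    = a
alternate a b (suc k) = alternate b a k

alternate-even : ∀ {a} {A : Set a} (x y : A) k → alternate x y (k * 2) ≡ x
alternate-even x y zero    = refl
alternate-even x y (suc k) = alternate-even x y k

alternate-cases : ∀ {a} {A : Set a} (x y : A) k → alternate x y k ≡ x ⊎ alternate x y k ≡ y
alternate-cases x y zero    = inj₁ refl
alternate-cases x y (suc k) = swap (alternate-cases y x k)

-- Pigeonhole: punching out a missed value would inject `Fin (suc n)` into `Fin n`.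
injective⇒inverse : ∀ {n} (f : Fin n → Fin n) → injective f →
  ∃[ g ] (∀ v → f (g v) ≡ v) × (∀ k → g (f k) ≡ k)
injective⇒inverse {n} f f-inj = (λ v → surjective v .proj₁) , (λ v → surjective v .proj₂) ,
  λ k → f-inj (surjective (f k) .proj₂)
  where
  surjective : ∀ v → ∃[ k ] f k ≡ v
  surjective v with Fin.any? (λ k → f k Fin.≟ v)
  ... | yes found = found
  ... | no  none  = contradiction (λ k eq → none (k , eq)) (missed f f-inj v)
    where
    missed : ∀ {n} (f : Fin n → Fin n) → injective f → ∀ v → ¬ (∀ k → f k ≢ v)
    missed {suc n} f f-inj v avoid = 1+n≰n (Fin.injective⇒≤ {f = λ k → punchOut (avoid k ∘ sym)}
      λ {k} {l} eq → f-inj (Fin.punchOut-injective (avoid k ∘ sym) (avoid l ∘ sym) eq))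

-- The path is indexed by ℕ but constrained only below `n`, where injectivity already makes it
-- Hamiltonian. As the alternation opens with `a`, the steps from positions `2k` to `2k + 1` form a
-- matching in colour `a`; all chords are taken from such matchings.
record PerfectColouring (n : ℕ) : Set where
  field
    colour         : Fin n → Fin n → Fin n
    colour-sym     : ∀ u v → colour u v ≡ colour v u
    path           : Fin n → Fin n → ℕ → Fin n
    path-injective : ∀ {a b} → a ≢ b → ∀ {k l} → k < n → l < n → path a b k ≡ path a b l → k ≡ l
    path-colour    : ∀ {a b} → a ≢ b → ∀ k → suc k < n →
      colour (path a b k) (path a b (suc k)) ≡ alternate a b k

module Family {M : ℕ} (C : PerfectColouring (2 + M)) (t L : ℕ)
  (1+M≤2^L : suc M ≤ 2 ^ L) (L-blocks : L * suc (3 * t) * 2 ≤ 2 + M)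
  (one-block : suc (3 * t) * 2 ≤ 2 + M) where

  open PerfectColouring C

  n m : ℕ
  n = 2 + M
  m = suc (3 * t)

  module Path {a b : Fin n} (a≢b : a ≢ b) where

    at : Fin n → Fin n
    at k = path a b (toℕ k)

    at-injective : injective at
    at-injective {k} {l} = Fin.toℕ-injective ∘ path-injective a≢b (Fin.toℕ<n k) (Fin.toℕ<n l)

    at-inverse = injective⇒inverse at at-injective

    pos : Fin n → Fin n
    pos = at-inverse .proj₁

    at-pos : ∀ v → at (pos v) ≡ v
    at-pos = at-inverse .proj₂ .proj₁

    pos-at : ∀ k → pos (at k) ≡ k
    pos-at = at-inverse .proj₂ .proj₂

    toℕ-pos : ∀ k → k < n → toℕ (pos (path a b k)) ≡ k
    toℕ-pos k k<n = trans (cong (toℕ ∘ pos ∘ path a b) (sym (Fin.toℕ-fromℕ< k<n)))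
      (trans (cong toℕ (pos-at (fromℕ< k<n))) (Fin.toℕ-fromℕ< k<n))

    at-colour : ∀ k → toℕ k < suc M → colour (at k) (at (next k)) ≡ alternate a b (toℕ k)
    at-colour k k<1+M = trans
      (cong (colour (at k) ∘ path a b) (toℕ-next k (s≤s k<1+M)))
      (path-colour a≢b (toℕ k) (s≤s k<1+M))

    edge : ℕ → Bool → Fin n
    edge k s = path a b (bitℕ s + k * 2)

    edge-bound : ∀ k s → suc k * 2 ≤ n → bitℕ s + k * 2 < n
    edge-bound k s = ≤-trans (s≤s (bit+k*2≤ s k))

    edge-injective : ∀ k l s s′ → suc k * 2 ≤ n → suc l * 2 ≤ n → edge k s ≡ edge l s′ → k ≡ l
    edge-injective k l s s′ k< l< eq = trans (sym ([bit+k*2]/2 s k)) (trans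
      (cong (_/ 2) (path-injective a≢b (edge-bound k s k<) (edge-bound l s′ l<) eq)) ([bit+k*2]/2 s′ l))

    edge-≢ : ∀ k → suc k * 2 ≤ n → edge k false ≢ edge k true
    edge-≢ k k< eq = 1+n≢n
      (sym (path-injective a≢b (edge-bound k false k<) (edge-bound k true k<) eq))

    edge-colour : ∀ k → suc k * 2 ≤ n → colour (edge k false) (edge k true) ≡ a
    edge-colour k k< = trans (path-colour a≢b (k * 2) k<) (alternate-even a b k)

  -- Colour 1 only lends an order: along the path of colours 0 and 1, edges of the reserved colour 0
  -- join the positions `2r` and `2r + 1`.
  module Reserve = Path {zero} {suc zero} (λ ())

  -- Half the position is the number of the reserved edge at `u`, and `m` consecutive edges form a
  -- block.
  block : Fin n → ℕ
  block u = toℕ (Reserve.pos u) / 2 / m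

  parity : (Fin (suc M) → Bool) → ℕ → Bool
  parity x b = sum (λ i → x i ∧ bit (toℕ i) b)

  -- Both ends of a reserved edge lie in one block, where the conjunction reduces to a single
  -- parity; mentioning both ends makes the definition symmetric.
  present : (Fin (suc M) → Bool) → Fin n → Fin n → Fin n → Bool
  present x zero    u v = parity x (block u) ∧ parity x (block v)
  present x (suc i) u v = x i

  graph : (Fin (suc M) → Bool) → Graph n
  graph x = graphOf (λ u v → present x (colour u v) u v) λ u v →
    trans (present-sym (colour u v) u v) (cong (λ c → present x c v u) (colour-sym u v))
    where
    present-sym : ∀ c u v → present x c u v ≡ present x c v u
    present-sym zero    u v = Bool.∧-comm (parity x (block u)) (parity x (block v))
    present-sym (suc i) u v = refl

  adj-graph : ∀ x {u v} → u ≢ v → adj (graph x) u v ≡ present x (colour u v) u v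
  adj-graph x {u} {v} u≢v with u Fin.≟ v
  ... | yes u≡v = contradiction u≡v u≢v
  ... | no  _   = refl

  offset-bound : ∀ {b i} → b < L → i < m → suc (i + b * m) * 2 ≤ n
  offset-bound {b} {i} b<L i<m = ≤-trans (*-monoˡ-≤ 2
    (≤-trans (+-monoˡ-≤ (b * m) i<m) (*-monoˡ-≤ m b<L))) L-blocks

  block-edge : ∀ {b i} s → b < L → i < m → block (Reserve.edge (i + b * m) s) ≡ b
  block-edge {b} {i} s b<L i<m = trans
    (cong (λ p → p / 2 / m) (Reserve.toℕ-pos _ (Reserve.edge-bound (i + b * m) s (offset-bound b<L i<m))))
    (trans (cong (_/ m) ([bit+k*2]/2 s (i + b * m)))
      (trans (+-distrib-/-∣ʳ i (divides-refl b))
        (cong₂ _+_ (m<n⇒m/n≡0 i<m) (m*n/n≡m b m))))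

  parity-xor : ∀ x y b → parity x b xor parity y b ≡ parity (λ i → x i xor y i) b
  parity-xor x y b = trans (sym (∑-distrib-+ (λ i → x i ∧ bit (toℕ i) b) (λ i → y i ∧ bit (toℕ i) b)))
    (sum-cong-≗ λ i → sym (Bool.∧-distribʳ-xor (bit (toℕ i) b) (x i) (y i)))

  module _ {x y : Fin (suc M) → Bool} (x-even : sum x ≡ false) (y-even : sum y ≡ false) where

    H : Graph n
    H = graph x ⊕ graph y

    z : Fin (suc M) → Bool
    z i = x i xor y i

    z-even : sum z ≡ false
    z-even = trans (∑-distrib-+ x y) (cong₂ _xor_ x-even y-even)

    adj-H : ∀ {u v c} → colour u v ≡ c → u ≢ v → present x c u v xor present y c u v ≡ true → Adj H u v
    adj-H refl u≢v e = subst T (sym (trans (cong₂ _xor_ (adj-graph x u≢v) (adj-graph y u≢v)) e)) tt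

    module _ {i j} (i≢j : i ≢ j) (zi : z i ≡ true) (zj : z j ≡ true) where

      open Path {suc i} {suc j} (i≢j ∘ Fin.suc-injective)

      path-adj : ∀ k → toℕ k < suc M → Adj H (at k) (at (next k))
      path-adj k k<1+M with alternate-cases (suc i) (suc j) (toℕ k) | at-colour k k<1+M
      ... | inj₁ eq | c = adj-H (trans c eq) at≢ zi
        where at≢ = λ e → 1+n≢n (trans (sym (toℕ-next k (s≤s k<1+M))) (cong toℕ (sym (at-injective e))))
      ... | inj₂ eq | c = adj-H (trans c eq) at≢ zj
        where at≢ = λ e → 1+n≢n (trans (sym (toℕ-next k (s≤s k<1+M))) (cong toℕ (sym (at-injective e))))

      -- Consecutive vertices of the path are joined in colour `suc i` or `suc j`, so an edge of
      -- another colour `c` never joins consecutive positions.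
      withMatching : ∀ c → c ≢ suc i → c ≢ suc j → (e : Fin m → Bool → Fin n) →
        (∀ r → colour (e r false) (e r true) ≡ c) → (∀ r → Adj H (e r false) (e r true)) →
        (∀ r r′ s s′ → e r s ≡ e r′ s′ → r ≡ r′) → 𝓕 (2 + t) n H
      withMatching c c≢i c≢j e e-colour adjacent disjoint = pathWithMatching⇒𝓕 H at pos at-pos pos-at
        path-adj e adjacent disjoint nonconsecutive ≤-refl
        where
        e-colour′ : ∀ r s → colour (e r s) (e r (not s)) ≡ c
        e-colour′ r false = e-colour r
        e-colour′ r true  = trans (colour-sym _ _) (e-colour r)
        nonconsecutive : ∀ r s → toℕ (pos (e r (not s))) ≢ suc (toℕ (pos (e r s)))
        nonconsecutive r s eq = [ c≢i ∘ trans c≡ , c≢j ∘ trans c≡ ]′ (alternate-cases (suc i) (suc j) (toℕ k))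
          where
          k = pos (e r s)
          k<1+M : toℕ k < suc M
          k<1+M = s≤s⁻¹ (subst (_< n) eq (Fin.toℕ<n (pos (e r (not s)))))
          next-k : next k ≡ pos (e r (not s))
          next-k = Fin.toℕ-injective (trans (toℕ-next k (s≤s k<1+M)) (sym eq))
          c≡ : c ≡ alternate (suc i) (suc j) (toℕ k)
          c≡ = trans (sym (e-colour′ r s)) (trans (cong₂ colour (sym (at-pos _))
            (trans (sym (at-pos _)) (cong at (sym next-k)))) (at-colour k k<1+M))

      third-colour : ∀ {k} → k ≢ i → k ≢ j → z k ≡ true → 𝓕 (2 + t) n H
      third-colour {k} k≢i k≢j zk = withMatching (suc k) (k≢i ∘ Fin.suc-injective) (k≢j ∘ Fin.suc-injective)
        (λ r → Third.edge (toℕ r)) (λ r → Third.edge-colour (toℕ r) (bound r))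
        (λ r → adj-H (Third.edge-colour (toℕ r) (bound r)) (Third.edge-≢ (toℕ r) (bound r)) zk)
        (λ r r′ s s′ → Fin.toℕ-injective ∘
          Third.edge-injective (toℕ r) (toℕ r′) s s′ (bound r) (bound r′))
        where
        k≢i′ : suc k ≢ suc i
        k≢i′ = k≢i ∘ Fin.suc-injective
        -- This second path serves for its even steps, a matching in colour `suc k`.
        module Third = Path k≢i′
        bound : ∀ (r : Fin m) → suc (toℕ r) * 2 ≤ n
        bound r = ≤-trans (*-monoˡ-≤ 2 (Fin.toℕ<n r)) one-block

      reserve-block : (∀ k → k ≢ i → k ≢ j → z k ≡ false) → 𝓕 (2 + t) n H
      reserve-block z≡0 with separating-bit L
        (<-≤-trans (Fin.toℕ<n i) 1+M≤2^L) (<-≤-trans (Fin.toℕ<n j) 1+M≤2^L) (i≢j ∘ Fin.toℕ-injective)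
      ... | b , b<L , bits≢ = withMatching zero (λ ()) (λ ()) e
        (λ r → Reserve.edge-colour (index r) (bound r))
        (λ r → adj-H (Reserve.edge-colour (index r) (bound r)) (Reserve.edge-≢ (index r) (bound r))
          (trans (cong₂ _xor_ (reserved x r) (reserved y r)) parities≢))
        (λ r r′ s s′ → Fin.toℕ-injective ∘ +-cancelʳ-≡ (b * m) (toℕ r) (toℕ r′) ∘
          Reserve.edge-injective (index r) (index r′) s s′ (bound r) (bound r′))
        where
        index : Fin m → ℕ
        index r = toℕ r + b * m
        e : Fin m → Bool → Fin n
        e r = Reserve.edge (index r)
        bound : ∀ r → suc (index r) * 2 ≤ n
        bound r = offset-bound b<L (Fin.toℕ<n r)
        reserved : ∀ x r → present x zero (e r false) (e r true) ≡ parity x b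
        reserved x r = trans
          (cong₂ (λ b b′ → parity x b ∧ parity x b′)
            (block-edge false b<L (Fin.toℕ<n r)) (block-edge true b<L (Fin.toℕ<n r)))
          (Bool.∧-idem (parity x b))
        -- By linearity this is the parity of `z`, to which only `i` and `j` contribute; their
        -- digits at `b` differ.
        parities≢ : parity x b xor parity y b ≡ true
        parities≢ = trans (parity-xor x y b) (trans
          (sum-pair _ i≢j λ k k≢i k≢j → cong (_∧ bit (toℕ k) b) (z≡0 k k≢i k≢j))
          (trans (cong₂ (λ p q → (p ∧ bit (toℕ i) b) xor (q ∧ bit (toℕ j) b)) zi zj) (xor-≢ bits≢)))

    differ⇒𝓕 : ∀ {i} → x i ≢ y i → 𝓕 (2 + t) n H
    differ⇒𝓕 {i} xi≢yi = finish (even-weight-partner z z-even i zi)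
      where
      zi : z i ≡ true
      zi = xor-≢ xi≢yi
      finish : (∃[ j ] j ≢ i × z j ≡ true) → 𝓕 (2 + t) n H
      finish (j , j≢i , zj) =
        split (Fin.any? λ k → ¬? (k Fin.≟ i) ×-dec ¬? (k Fin.≟ j) ×-dec (z k Bool.≟ true))
        where
        split : Dec (∃[ k ] k ≢ i × k ≢ j × z k ≡ true) → 𝓕 (2 + t) n H
        split (yes (k , k≢i , k≢j , zk)) = third-colour (j≢i ∘ sym) zi zj k≢i k≢j zk
        split (no none) = reserve-block (j≢i ∘ sym) zi zj
          λ k k≢i k≢j → Bool.¬-not λ zk → none (k , k≢i , k≢j , zk)

  word : Fin (2 ^ M) → Fin M → Bool
  word c = Inverse.to Fin.2↔Bool ∘ finToFun c

  funToFin-cong : ∀ {k} {f g : Fin k → Fin 2} → (∀ i → f i ≡ g i) → funToFin f ≡ funToFin g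
  funToFin-cong {zero}  _ = refl
  funToFin-cong {suc k} e = cong₂ combine (e zero) (funToFin-cong (e ∘ suc))

  word-injective : ∀ {c d} → (∀ i → word c i ≡ word d i) → c ≡ d
  word-injective {c} {d} eq = trans (sym (Fin.funToFin-finToFin {M} c)) (trans
    (funToFin-cong λ i → to-injective (eq i)) (Fin.funToFin-finToFin {M} d))
    where
    open Inverse Fin.2↔Bool
    to-injective : injective to
    to-injective eq = trans (sym (strictlyInverseʳ _)) (trans (cong from eq) (strictlyInverseʳ _))

  -- The first entry is a parity check, which leaves `M = n - 2` free entries.
  evenWord : (Fin M → Bool) → Fin (suc M) → Bool
  evenWord f zero    = sum f
  evenWord f (suc i) = f i

  hasCode : HasCode (2 + t) n (2 ^ M)
  hasCode = (λ c → graph (evenWord (word c))) , λ c d c≢d →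
    let i , differ = Fin.¬∀⟶∃¬ M (λ i → word c i ≡ word d i) (λ i → word c i Bool.≟ word d i)
          (c≢d ∘ word-injective)
    in differ⇒𝓕 {evenWord (word c)} {evenWord (word d)}
         (Bool.xor-same (sum (word c))) (Bool.xor-same (sum (word d))) {suc i} differ

-- Perfect colourings from reflections of ℤ/p

halve : ∀ k → ∃[ j ] (k ≡ j * 2 ⊎ k ≡ suc (j * 2))
halve zero    = 0 , inj₁ refl
halve (suc k) with halve k
... | j , inj₁ refl = j , inj₂ refl
... | j , inj₂ refl = suc j , inj₁ refl

alternate-shift : ∀ {a} {A : Set a} (x y : A) j k → alternate x y (j * 2 + k) ≡ alternate x y k
alternate-shift x y zero    k = refl
alternate-shift x y (suc j) k = alternate-shift x y j k

alternate-map : ∀ {a b} {A : Set a} {B : Set b} (f : A → B) x y k →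
  f (alternate x y k) ≡ alternate (f x) (f y) k
alternate-map f x y zero    = refl
alternate-map f x y (suc k) = alternate-map f y x k

-- Congruences and alternating reflections modulo a prime

module Modular (p : ℕ) (p-prime : Prime p) where


  instance _ = prime⇒nonZero p-prime

  infix 4 _≈_
  record _≈_ (x y : ℤ) : Set where
    constructor mod
    field p∣ : + p ∣ℤ x -ᶻ y
  open _≈_

  -- Congruences are derived by exhibiting a difference as an integer combination of known
  -- differences; the remaining identity is left to the ring solver.
  combine₁ : ∀ {x y a b} k → a ≈ b → x -ᶻ y ≡ k *ᶻ (a -ᶻ b) → x ≈ y
  combine₁ k (mod d) eq = mod (subst (+ p ∣ℤ_) (sym eq) (∣n⇒∣m*n k d))

  combine₂ : ∀ {x y a b c d} k l → a ≈ b → c ≈ d → x -ᶻ y ≡ k *ᶻ (a -ᶻ b) +ᶻ l *ᶻ (c -ᶻ d) → x ≈ y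
  combine₂ k l (mod d) (mod e) eq = mod (subst (+ p ∣ℤ_) (sym eq) (∣m∣n⇒∣m+n (∣n⇒∣m*n k d) (∣n⇒∣m*n l e)))

  ≈-reflexive : ∀ {x y} → x ≡ y → x ≈ y
  ≈-reflexive {x} refl = mod (divides 0ℤ (ℤ.+-inverseʳ x))

  ≈-sym : ∀ {x y} → x ≈ y → y ≈ x
  ≈-sym {x} {y} e = combine₁ -1ℤ e (lemma x y)
    where
    lemma : ∀ x y → y -ᶻ x ≡ -1ℤ *ᶻ (x -ᶻ y)
    lemma = solve-∀

  ≈-trans : ∀ {x y z} → x ≈ y → y ≈ z → x ≈ z
  ≈-trans {x} {y} {z} e f = combine₂ 1ℤ 1ℤ e f (lemma x y z)
    where
    lemma : ∀ x y z → x -ᶻ z ≡ 1ℤ *ᶻ (x -ᶻ y) +ᶻ 1ℤ *ᶻ (y -ᶻ z)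
    lemma = solve-∀

  -‿cong : ∀ a {x y} → x ≈ y → a -ᶻ x ≈ a -ᶻ y
  -‿cong a {x} {y} e = combine₁ -1ℤ e (lemma a x y)
    where
    lemma : ∀ a x y → (a -ᶻ x) -ᶻ (a -ᶻ y) ≡ -1ℤ *ᶻ (x -ᶻ y)
    lemma = solve-∀

  +-cong : ∀ a {x y} → x ≈ y → a +ᶻ x ≈ a +ᶻ y
  +-cong a {x} {y} e = combine₁ 1ℤ e (lemma a x y)
    where
    lemma : ∀ a x y → (a +ᶻ x) -ᶻ (a +ᶻ y) ≡ 1ℤ *ᶻ (x -ᶻ y)
    lemma = solve-∀

  residue-unique : ∀ {r s} → r < p → s < p → + r ≈ + s → r ≡ s
  residue-unique {r} {s} r<p s<p (mod d) = ℤ.+-injective (ℤ.i-j≡0⇒i≡j (+ r) (+ s) (ℤ.∣i∣≡0⇒i≡0 ∣r-s∣≡0))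
    where
    ∣r-s∣<p : ∣ + r -ᶻ + s ∣ < p
    ∣r-s∣<p = ≤-<-trans (≤-trans (≤-reflexive (cong ∣_∣ (ℤ.m-n≡m⊖n r s))) (ℤ.∣m⊝n∣≤m⊔n r s))
      (⊔-pres-<m r<p s<p)
    ∣r-s∣≡0 : ∣ + r -ᶻ + s ∣ ≡ 0
    ∣r-s∣≡0 with ∣ + r -ᶻ + s ∣ | ∣⇒∣ᵤ d | ∣r-s∣<p
    ... | zero  | _ | _  = refl
    ... | suc q | e | lt = contradiction (∣⇒≤ e) (<⇒≱ lt)

  p∣⇒≈0 : ∀ {x} → + p ∣ℤ x → x ≈ 0ℤ
  p∣⇒≈0 {x} d = mod (subst (+ p ∣ℤ_) (sym (ℤ.+-identityʳ x)) d)

  -- Euclid's lemma: ℤ/p has no zero divisors.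
  *-≈0 : ∀ x y → x *ᶻ y ≈ 0ℤ → x ≈ 0ℤ ⊎ y ≈ 0ℤ
  *-≈0 x y (mod d) with euclidsLemma ∣ x ∣ ∣ y ∣ p-prime
    (subst (p ∣_) (ℤ.abs-* x y) (∣⇒∣ᵤ (subst (+ p ∣ℤ_) (ℤ.+-identityʳ (x *ᶻ y)) d)))
  ... | inj₁ e = inj₁ (p∣⇒≈0 (∣ᵤ⇒∣ e))
  ... | inj₂ e = inj₂ (p∣⇒≈0 (∣ᵤ⇒∣ e))

  [_] : ℤ → Fin p
  [ x ] = fromℕ< (ℤ.n%ℕd<d x p)

  ⟦_⟧ : Fin p → ℤ
  ⟦ u ⟧ = + toℕ u

  ⟦[]⟧ : ∀ x → ⟦ [ x ] ⟧ ≈ x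
  ⟦[]⟧ x = mod (divides (-ᶻ (x /ℕ p)) (trans
    (cong₂ (λ r y → + r -ᶻ y) (Fin.toℕ-fromℕ< (ℤ.n%ℕd<d x p)) (ℤ.a≡a%ℕn+[a/ℕn]*n x p))
    (lemma (+ (x %ℕ p)) (x /ℕ p) (+ p))))
    where
    lemma : ∀ r q p → r -ᶻ (r +ᶻ q *ᶻ p) ≡ -ᶻ q *ᶻ p
    lemma = solve-∀

  ⟦⟧-injective : ∀ {u v} → ⟦ u ⟧ ≈ ⟦ v ⟧ → u ≡ v
  ⟦⟧-injective {u} {v} e = Fin.toℕ-injective (residue-unique (Fin.toℕ<n u) (Fin.toℕ<n v) e)

  []-≡ : ∀ {x u} → x ≈ ⟦ u ⟧ → [ x ] ≡ u
  []-≡ {x} e = ⟦⟧-injective (≈-trans (⟦[]⟧ x) e)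

  ≡-[] : ∀ {x u} → [ x ] ≡ u → x ≈ ⟦ u ⟧
  ≡-[] {x} refl = ≈-sym (⟦[]⟧ x)

  []-injective : ∀ {x y} → [ x ] ≡ [ y ] → x ≈ y
  []-injective {x} {y} e = ≈-trans (≡-[] e) (⟦[]⟧ y)

  -- The orbit of `x` under the reflections `x ↦ a - x` and `x ↦ b - x` in turn. Neighbouring terms
  -- add up to `a` and `b` alternately, so a colouring by sums sees an alternating walk.
  reflections : ℤ → ℤ → ℤ → ℕ → ℤ
  reflections a b x zero    = x
  reflections a b x (suc k) = reflections b a (a -ᶻ x) k

  reflections-cong : ∀ a b {x y} k → x ≈ y → reflections a b x k ≈ reflections a b y k
  reflections-cong a b zero    e = e
  reflections-cong a b (suc k) e = reflections-cong b a k (-‿cong a e)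

  reflections-sum : ∀ a b x k →
    reflections a b x k +ᶻ reflections a b x (suc k) ≡ alternate a b k
  reflections-sum a b x zero    = lemma a x
    where
    lemma : ∀ a x → x +ᶻ (a -ᶻ x) ≡ a
    lemma = solve-∀
  reflections-sum a b x (suc k) = reflections-sum b a (a -ᶻ x) k

  -- Two reflections compose to the translation by `b - a`.
  reflections-even : ∀ a b x j → reflections a b x (j * 2) ≡ x +ᶻ + j *ᶻ (b -ᶻ a)
  reflections-even a b x zero    = lemma x (b -ᶻ a)
    where
    lemma : ∀ x d → x ≡ x +ᶻ 0ℤ *ᶻ d
    lemma = solve-∀
  reflections-even a b x (suc j) = trans (reflections-even a b (b -ᶻ (a -ᶻ x)) j) (lemma a b x (+ j))
    where
    lemma : ∀ a b x j → b -ᶻ (a -ᶻ x) +ᶻ j *ᶻ (b -ᶻ a) ≡ x +ᶻ (1ℤ +ᶻ j) *ᶻ (b -ᶻ a)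
    lemma = solve-∀

  -≈0⇒≈ : ∀ {x y} → x -ᶻ y ≈ 0ℤ → x ≈ y
  -≈0⇒≈ {x} {y} (mod d) = mod (subst (+ p ∣ℤ_) (ℤ.+-identityʳ (x -ᶻ y)) d)

  -- A coincidence says `(i - j)(b - a) ≡ 0`; the second factor is nonzero modulo `p`, and residues
  -- below `p` are unique.
  evens-distinct : ∀ {a b} → ¬ a ≈ b → ∀ x {i j} → i < p → j < p →
    reflections a b x (i * 2) ≈ reflections a b x (j * 2) → i ≡ j
  evens-distinct {a} {b} a≉b x {i} {j} i<p j<p e =
    [ residue-unique i<p j<p ∘ -≈0⇒≈ , (λ b-a≈0 → contradiction (≈-sym (-≈0⇒≈ b-a≈0)) a≉b) ]′
    (*-≈0 (+ i -ᶻ + j) (b -ᶻ a) (combine₁ 1ℤ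
      (≈-trans (≈-reflexive (sym (reflections-even a b x i)))
        (≈-trans e (≈-reflexive (reflections-even a b x j))))
      (identity x (+ i) (+ j) (b -ᶻ a))))
    where
    identity : ∀ x i j d → (i -ᶻ j) *ᶻ d -ᶻ 0ℤ ≡ 1ℤ *ᶻ ((x +ᶻ i *ᶻ d) -ᶻ (x +ᶻ j *ᶻ d))
    identity = solve-∀

  half-< : ∀ {k} j → j * 2 ≤ k → k < p * 2 → j < p
  half-< j j*2≤k k<p*2 = *-cancelʳ-< 2 j p (≤-<-trans j*2≤k k<p*2)

-- The colouring of ℤ/p by sums

module SumColouring (p : ℕ) (p-prime : Prime p) (h : ℕ) (p-odd : p ≡ suc (h * 2)) where

  open Modular p p-prime

  -- Half of `b` modulo `p`, because `2 (h + 1) = p + 1`. It is the fixed point of `x ↦ b - x`, a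
  -- vertex without an edge of colour `b`, hence the end of the path that opens with colour `a`.
  start : Fin p → ℤ
  start b = (1ℤ +ᶻ + h) *ᶻ ⟦ b ⟧

  2start : ∀ b → start b +ᶻ start b ≈ ⟦ b ⟧
  2start b = mod (divides ⟦ b ⟧ (trans (lemma (+ h) ⟦ b ⟧) (cong (⟦ b ⟧ *ᶻ_)
    (trans (cong (λ q → 1ℤ +ᶻ q) (sym (ℤ.pos-* h 2))) (cong +_ (sym p-odd))))))
    where
    lemma : ∀ h b → ((1ℤ +ᶻ h) *ᶻ b +ᶻ (1ℤ +ᶻ h) *ᶻ b) -ᶻ b ≡ b *ᶻ (1ℤ +ᶻ h *ᶻ + 2)
    lemma = solve-∀

  walk : Fin p → Fin p → ℕ → ℤ
  walk a b = reflections ⟦ a ⟧ ⟦ b ⟧ (start b)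

  -- Since twice the start is `b`, a coincidence would give `(1 + i + j)(b - a) ≡ 0`, while
  -- `0 < 1 + i + j < p`.
  even≉odd : ∀ {a b} → a ≢ b → ∀ i j → i * 2 < p → suc (j * 2) < p →
    ¬ (walk a b (i * 2) ≈ walk a b (suc (j * 2)))
  even≉odd {a} {b} a≢b i j i< j< e =
    [ (λ 1+i+j≈0 → contradiction (residue-unique 1+i+j<p (≤-<-trans z≤n i<) 1+i+j≈0) 1+n≢0)
    , (λ b-a≈0 → a≢b (sym (⟦⟧-injective (-≈0⇒≈ b-a≈0)))) ]′
    (*-≈0 (+ suc (i + j)) (⟦ b ⟧ -ᶻ ⟦ a ⟧) product≈0)
    where
    identity : ∀ a b x i j → (1ℤ +ᶻ (i +ᶻ j)) *ᶻ (b -ᶻ a) -ᶻ 0ℤ ≡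
      1ℤ *ᶻ ((x +ᶻ i *ᶻ (b -ᶻ a)) -ᶻ ((a -ᶻ x) +ᶻ j *ᶻ (a -ᶻ b))) +ᶻ -1ℤ *ᶻ (x +ᶻ x -ᶻ b)
    identity = solve-∀
    product≈0 : + suc (i + j) *ᶻ (⟦ b ⟧ -ᶻ ⟦ a ⟧) ≈ 0ℤ
    product≈0 = combine₂ 1ℤ -1ℤ
      (≈-trans (≈-reflexive (sym (reflections-even ⟦ a ⟧ ⟦ b ⟧ (start b) i)))
        (≈-trans e (≈-reflexive (reflections-even ⟦ b ⟧ ⟦ a ⟧ (⟦ a ⟧ -ᶻ start b) j))))
      (2start b) (identity ⟦ a ⟧ ⟦ b ⟧ (start b) (+ i) (+ j))
    open ≤-Reasoning
    1+i+j<p : suc (i + j) < p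
    1+i+j<p = *-cancelʳ-< 2 _ _ (begin-strict
      suc (i + j) * 2          ≡⟨ cong (λ q → suc (suc q)) (*-distribʳ-+ 2 i j) ⟩
      suc (suc (i * 2 + j * 2)) ≡⟨ cong suc (+-suc (i * 2) (j * 2)) ⟨
      suc (i * 2) + suc (j * 2) <⟨ +-mono-≤-< i< j< ⟩
      p + p                    ≡⟨ cong (λ q → p + q) (+-identityʳ p) ⟨
      2 * p                    ≡⟨ *-comm 2 p ⟩
      p * 2                    ∎)

  walk-injective : ∀ {a b} → a ≢ b → ∀ {k l} → k < p → l < p → walk a b k ≈ walk a b l → k ≡ l
  walk-injective {a} {b} a≢b {k} {l} = cases (halve k) (halve l)
    where
    cases : ∀ {k l} → ∃[ i ] (k ≡ i * 2 ⊎ k ≡ suc (i * 2)) → ∃[ j ] (l ≡ j * 2 ⊎ l ≡ suc (j * 2)) →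
      k < p → l < p → walk a b k ≈ walk a b l → k ≡ l
    cases (i , inj₁ refl) (j , inj₁ refl) k<p l<p e = cong (_* 2)
      (evens-distinct (a≢b ∘ ⟦⟧-injective) (start b)
        (≤-<-trans (m≤m*n i 2) k<p) (≤-<-trans (m≤m*n j 2) l<p) e)
    cases (i , inj₂ refl) (j , inj₂ refl) k<p l<p e = cong (λ q → suc (q * 2))
      (evens-distinct (a≢b ∘ sym ∘ ⟦⟧-injective) (⟦ a ⟧ -ᶻ start b)
        (≤-<-trans (m≤m*n i 2) (<-trans (n<1+n _) k<p)) (≤-<-trans (m≤m*n j 2) (<-trans (n<1+n _) l<p)) e)
    cases (i , inj₁ refl) (j , inj₂ refl) k<p l<p e = contradiction e (even≉odd a≢b i j k<p l<p)
    cases (i , inj₂ refl) (j , inj₁ refl) k<p l<p e = contradiction (≈-sym e) (even≉odd a≢b j i l<p k<p)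

  colouring : PerfectColouring p
  colouring = record
    { colour         = λ u v → [ ⟦ u ⟧ +ᶻ ⟦ v ⟧ ]
    ; colour-sym     = λ u v → cong [_] (ℤ.+-comm ⟦ u ⟧ ⟦ v ⟧)
    ; path           = λ a b k → [ walk a b k ]
    ; path-injective = λ a≢b k<p l<p eq → walk-injective a≢b k<p l<p ([]-injective eq)
    ; path-colour    = λ {a} {b} _ k _ → []-≡ (path-sum a b k)
    }
    where
    path-sum : ∀ a b k → ⟦ [ walk a b k ] ⟧ +ᶻ ⟦ [ walk a b (suc k) ] ⟧ ≈ ⟦ alternate a b k ⟧
    path-sum a b k = ≈-trans
      (combine₂ 1ℤ 1ℤ (⟦[]⟧ (walk a b k)) (⟦[]⟧ (walk a b (suc k)))
        (lemma ⟦ [ walk a b k ] ⟧ ⟦ [ walk a b (suc k) ] ⟧ (walk a b k) (walk a b (suc k))))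
      (≈-reflexive (trans (reflections-sum ⟦ a ⟧ ⟦ b ⟧ (start b) k) (sym (alternate-map ⟦_⟧ a b k))))
      where
      lemma : ∀ u v x y → (u +ᶻ v) -ᶻ (x +ᶻ y) ≡ 1ℤ *ᶻ (u -ᶻ x) +ᶻ 1ℤ *ᶻ (v -ᶻ y)
      lemma = solve-∀

-- Anderson's perfect one-factorisation of the complete graph on ℤ/p × {0, 1}, of which the
-- vertex (0, 1) is then deleted. The factor inj₁ s joins x to s - x in both layers, and the two
-- copies of s / 2 to each other; the factor inj₂ d joins (x , 0) to (x + d + 1 , 1).
module LayerColouring (q : ℕ) (p-prime : Prime (3 + q)) where

  p p-1 : ℕ
  p   = 3 + q
  p-1 = 2 + q

  open Modular p p-prime

  Vertex Factor : Set
  Vertex = Fin p × Bool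
  Factor = Fin p ⊎ Fin p-1

  crossFactor : (d s : Fin p) → Factor
  crossFactor zero    s = inj₁ s
  crossFactor (suc d) s = inj₂ d

  cross : Fin p → Fin p → Factor
  cross x y = crossFactor [ ⟦ y ⟧ -ᶻ ⟦ x ⟧ ] [ ⟦ x ⟧ +ᶻ ⟦ y ⟧ ]

  factor : Vertex → Vertex → Factor
  factor (x , false) (y , false) = inj₁ [ ⟦ x ⟧ +ᶻ ⟦ y ⟧ ]
  factor (x , true)  (y , true)  = inj₁ [ ⟦ x ⟧ +ᶻ ⟦ y ⟧ ]
  factor (x , false) (y , true)  = cross x y
  factor (x , true)  (y , false) = cross y x

  factor-sym : ∀ u v → factor u v ≡ factor v u
  factor-sym (x , false) (y , false) = cong (inj₁ ∘ [_]) (ℤ.+-comm ⟦ x ⟧ ⟦ y ⟧)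
  factor-sym (x , true)  (y , true)  = cong (inj₁ ∘ [_]) (ℤ.+-comm ⟦ x ⟧ ⟦ y ⟧)
  factor-sym (x , false) (y , true)  = refl
  factor-sym (x , true)  (y , false) = refl

  reflect : Fin p → Fin p → Fin p
  reflect s x = [ ⟦ s ⟧ -ᶻ ⟦ x ⟧ ]

  reflect-≈ : ∀ s x → ⟦ reflect s x ⟧ ≈ ⟦ s ⟧ -ᶻ ⟦ x ⟧
  reflect-≈ s x = ⟦[]⟧ _

  reflect-involutive : ∀ s x → reflect s (reflect s x) ≡ x
  reflect-involutive s x = []-≡ (≈-trans (-‿cong ⟦ s ⟧ (reflect-≈ s x)) (≈-reflexive (identity ⟦ s ⟧ ⟦ x ⟧)))
    where
    identity : ∀ s x → s -ᶻ (s -ᶻ x) ≡ x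
    identity = solve-∀

  reflect-sum : ∀ s x → [ ⟦ x ⟧ +ᶻ ⟦ reflect s x ⟧ ] ≡ s
  reflect-sum s x = []-≡ (≈-trans (+-cong ⟦ x ⟧ (reflect-≈ s x)) (≈-reflexive (identity ⟦ s ⟧ ⟦ x ⟧)))
    where
    identity : ∀ s x → x +ᶻ (s -ᶻ x) ≡ s
    identity = solve-∀

  reflectLayer : ∀ {s x} → Dec (reflect s x ≡ x) → Bool → Bool
  reflectLayer (yes _) i = not i
  reflectLayer (no  _) i = i

  mate : Factor → Vertex → Vertex
  mate (inj₁ s) (x , i)     = reflect s x , reflectLayer {s} {x} (reflect s x Fin.≟ x) i
  mate (inj₂ d) (x , false) = [ ⟦ x ⟧ +ᶻ ⟦ suc d ⟧ ] , true
  mate (inj₂ d) (x , true)  = [ ⟦ x ⟧ -ᶻ ⟦ suc d ⟧ ] , false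

  crossFactor-diagonal : ∀ {d} s → d ≡ zero → crossFactor d s ≡ inj₁ s
  crossFactor-diagonal s refl = refl

  crossFactor-shift : ∀ {d d′} s → d ≡ suc d′ → crossFactor d s ≡ inj₂ d′
  crossFactor-shift s refl = refl

  cross-fixed : ∀ {s x} → reflect s x ≡ x → cross x (reflect s x) ≡ inj₁ s
  cross-fixed {s} {x} fixed = trans
    (crossFactor-diagonal _ ([]-≡ (≈-trans (≈-reflexive (cong (λ y → ⟦ y ⟧ -ᶻ ⟦ x ⟧) fixed))
      (≈-reflexive (ℤ.+-inverseʳ ⟦ x ⟧)))))
    (cong inj₁ (reflect-sum s x))

  cross-fixed′ : ∀ {s x} → reflect s x ≡ x → cross (reflect s x) x ≡ inj₁ s
  cross-fixed′ {s} {x} fixed = trans (cong₂ cross fixed (sym fixed)) (cross-fixed fixed)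

  mate-factor : ∀ c v → factor v (mate c v) ≡ c
  mate-factor (inj₁ s) (x , i) = lemma i (reflect s x Fin.≟ x)
    where
    lemma : ∀ i (d : Dec (reflect s x ≡ x)) →
      factor (x , i) (reflect s x , reflectLayer {s} {x} d i) ≡ inj₁ s
    lemma false (yes fixed) = cross-fixed fixed
    lemma true  (yes fixed) = cross-fixed′ fixed
    lemma false (no _)      = cong inj₁ (reflect-sum s x)
    lemma true  (no _)      = cong inj₁ (reflect-sum s x)
  mate-factor (inj₂ d) (x , false) = crossFactor-shift _ ([]-≡ {⟦ y ⟧ -ᶻ ⟦ x ⟧}
    (combine₁ 1ℤ (⟦[]⟧ (⟦ x ⟧ +ᶻ ⟦ suc d ⟧)) (identity ⟦ y ⟧ ⟦ x ⟧ ⟦ suc d ⟧)))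
    where
    y = [ ⟦ x ⟧ +ᶻ ⟦ suc d ⟧ ]
    identity : ∀ y x d → y -ᶻ x -ᶻ d ≡ 1ℤ *ᶻ (y -ᶻ (x +ᶻ d))
    identity = solve-∀
  mate-factor (inj₂ d) (x , true) = crossFactor-shift _ ([]-≡ {⟦ x ⟧ -ᶻ ⟦ y ⟧}
    (combine₁ -1ℤ (⟦[]⟧ (⟦ x ⟧ -ᶻ ⟦ suc d ⟧)) (identity ⟦ y ⟧ ⟦ x ⟧ ⟦ suc d ⟧)))
    where
    y = [ ⟦ x ⟧ -ᶻ ⟦ suc d ⟧ ]
    identity : ∀ y x d → x -ᶻ y -ᶻ d ≡ -1ℤ *ᶻ (y -ᶻ (x -ᶻ d))
    identity = solve-∀

  mate-involutive : ∀ c v → mate c (mate c v) ≡ v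
  mate-involutive (inj₁ s) (x , i) = cong₂ _,_ (reflect-involutive s x)
    (lemma (reflect s x Fin.≟ x) (reflect s (reflect s x) Fin.≟ reflect s x))
    where
    lemma : (d : Dec (reflect s x ≡ x)) (d′ : Dec (reflect s (reflect s x) ≡ reflect s x)) →
      reflectLayer {s} {reflect s x} d′ (reflectLayer {s} {x} d i) ≡ i
    lemma (yes _)     (yes _)  = Bool.not-involutive i
    lemma (yes fixed) (no moved) = contradiction (cong (reflect s) fixed) moved
    lemma (no moved)  (yes fixed) = contradiction (trans (sym fixed) (reflect-involutive s x)) moved
    lemma (no _)      (no _)   = refl
  mate-involutive (inj₂ d) (x , false) = cong (_, false) ([]-≡ {⟦ y ⟧ -ᶻ ⟦ suc d ⟧}
    (combine₁ 1ℤ (⟦[]⟧ (⟦ x ⟧ +ᶻ ⟦ suc d ⟧)) (identity ⟦ y ⟧ ⟦ x ⟧ ⟦ suc d ⟧)))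
    where
    y = [ ⟦ x ⟧ +ᶻ ⟦ suc d ⟧ ]
    identity : ∀ y x d → y -ᶻ d -ᶻ x ≡ 1ℤ *ᶻ (y -ᶻ (x +ᶻ d))
    identity = solve-∀
  mate-involutive (inj₂ d) (x , true) = cong (_, true) ([]-≡ {⟦ y ⟧ +ᶻ ⟦ suc d ⟧}
    (combine₁ 1ℤ (⟦[]⟧ (⟦ x ⟧ -ᶻ ⟦ suc d ⟧)) (identity ⟦ y ⟧ ⟦ x ⟧ ⟦ suc d ⟧)))
    where
    y = [ ⟦ x ⟧ -ᶻ ⟦ suc d ⟧ ]
    identity : ∀ y x d → y +ᶻ d -ᶻ x ≡ 1ℤ *ᶻ (y -ᶻ (x -ᶻ d))
    identity = solve-∀

  mate-≢ : ∀ c v → mate c v ≢ v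
  mate-≢ (inj₁ s) (x , i) eq = lemma i (reflect s x Fin.≟ x) (cong proj₁ eq) (cong proj₂ eq)
    where
    lemma : ∀ i (d : Dec (reflect s x ≡ x)) → reflect s x ≡ x → reflectLayer {s} {x} d i ≢ i
    lemma i (yes _)    _     not-i≡i = Bool.not-¬ refl (sym not-i≡i)
    lemma i (no moved) fixed _       = moved fixed
  mate-≢ (inj₂ d) (x , false) eq = contradiction (cong proj₂ eq) λ ()
  mate-≢ (inj₂ d) (x , true)  eq = contradiction (cong proj₂ eq) λ ()

  -- A map to ℤ/p that turns two factors into two different reflections.
  record Projection (c c′ : Factor) : Set where
    field
      w   : Vertex → ℤ
      α β : ℤ
      w-c  : ∀ v → w (mate c v) ≈ α -ᶻ w v
      w-c′ : ∀ v → w (mate c′ v) ≈ β -ᶻ w v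
      α≉β : ¬ α ≈ β

  Projection-sym : ∀ {c c′} → Projection c c′ → Projection c′ c
  Projection-sym π = record { w = w ; α = β ; β = α ; w-c = w-c′ ; w-c′ = w-c ; α≉β = α≉β ∘ ≈-sym }
    where open Projection π

  -- The sign on the second layer turns the shift by `d` between the layers into the reflection
  -- `x ↦ -d - x`.
  signed : Vertex → ℤ
  signed (x , false) = ⟦ x ⟧
  signed (x , true)  = -ᶻ ⟦ x ⟧

  signed-shift : ∀ d v → signed (mate (inj₂ d) v) ≈ (-ᶻ ⟦ suc d ⟧) -ᶻ signed v
  signed-shift d (x , false) = combine₁ -1ℤ
    (⟦[]⟧ (⟦ x ⟧ +ᶻ ⟦ suc d ⟧)) (identity ⟦ [ ⟦ x ⟧ +ᶻ ⟦ suc d ⟧ ] ⟧ ⟦ x ⟧ ⟦ suc d ⟧)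
    where
    identity : ∀ y x d → (-ᶻ y) -ᶻ ((-ᶻ d) -ᶻ x) ≡ -1ℤ *ᶻ (y -ᶻ (x +ᶻ d))
    identity = solve-∀
  signed-shift d (x , true) = combine₁ 1ℤ
    (⟦[]⟧ (⟦ x ⟧ -ᶻ ⟦ suc d ⟧)) (identity ⟦ [ ⟦ x ⟧ -ᶻ ⟦ suc d ⟧ ] ⟧ ⟦ x ⟧ ⟦ suc d ⟧)
    where
    identity : ∀ y x d → y -ᶻ ((-ᶻ d) -ᶻ (-ᶻ x)) ≡ 1ℤ *ᶻ (y -ᶻ (x -ᶻ d))
    identity = solve-∀

  -- Centred so that both kinds of edges of the factor `inj₁ s` negate the value: the reflection
  -- within a layer, and the change of layer at its fixed point. A shift by `d` becomes the
  -- reflection `x ↦ -2d - x`.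
  centred : Fin p → Vertex → ℤ
  centred s (x , false) = ⟦ x ⟧ +ᶻ ⟦ x ⟧ -ᶻ ⟦ s ⟧
  centred s (x , true)  = ⟦ s ⟧ -ᶻ (⟦ x ⟧ +ᶻ ⟦ x ⟧)

  centred-reflect : ∀ s v → centred s (mate (inj₁ s) v) ≈ 0ℤ -ᶻ centred s v
  centred-reflect s (x , i) = lemma i (reflect s x Fin.≟ x)
    where
    y = reflect s x
    sum≈ : ⟦ y ⟧ ≈ ⟦ s ⟧ -ᶻ ⟦ x ⟧
    sum≈ = reflect-≈ s x
    lemma : ∀ i (d : Dec (y ≡ x)) → centred s (y , reflectLayer {s} {x} d i) ≈ 0ℤ -ᶻ centred s (x , i)
    lemma false (yes fixed) = ≈-reflexive (trans (cong (λ y → ⟦ s ⟧ -ᶻ (⟦ y ⟧ +ᶻ ⟦ y ⟧)) fixed) (identity ⟦ s ⟧ ⟦ x ⟧))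
      where
      identity : ∀ s x → s -ᶻ (x +ᶻ x) ≡ 0ℤ -ᶻ (x +ᶻ x -ᶻ s)
      identity = solve-∀
    lemma true (yes fixed) = ≈-reflexive (trans (cong (λ y → ⟦ y ⟧ +ᶻ ⟦ y ⟧ -ᶻ ⟦ s ⟧) fixed) (identity ⟦ s ⟧ ⟦ x ⟧))
      where
      identity : ∀ s x → (x +ᶻ x) -ᶻ s ≡ 0ℤ -ᶻ (s -ᶻ (x +ᶻ x))
      identity = solve-∀
    lemma false (no _) = combine₁ (+ 2) sum≈ (identity ⟦ s ⟧ ⟦ x ⟧ ⟦ y ⟧)
      where
      identity : ∀ s x y → (y +ᶻ y -ᶻ s) -ᶻ (0ℤ -ᶻ (x +ᶻ x -ᶻ s)) ≡ + 2 *ᶻ (y -ᶻ (s -ᶻ x))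
      identity = solve-∀
    lemma true (no _) = combine₁ (-ᶻ + 2) sum≈ (identity ⟦ s ⟧ ⟦ x ⟧ ⟦ y ⟧)
      where
      identity : ∀ s x y → (s -ᶻ (y +ᶻ y)) -ᶻ (0ℤ -ᶻ (s -ᶻ (x +ᶻ x))) ≡ (-ᶻ + 2) *ᶻ (y -ᶻ (s -ᶻ x))
      identity = solve-∀

  centred-shift : ∀ s d v →
    centred s (mate (inj₂ d) v) ≈ (-ᶻ (+ 2 *ᶻ ⟦ suc d ⟧)) -ᶻ centred s v
  centred-shift s d (x , false) = combine₁ (-ᶻ + 2)
    (⟦[]⟧ (⟦ x ⟧ +ᶻ ⟦ suc d ⟧)) (identity ⟦ [ ⟦ x ⟧ +ᶻ ⟦ suc d ⟧ ] ⟧ ⟦ s ⟧ ⟦ x ⟧ ⟦ suc d ⟧)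
    where
    identity : ∀ y s x d → (s -ᶻ (y +ᶻ y)) -ᶻ ((-ᶻ (+ 2 *ᶻ d)) -ᶻ (x +ᶻ x -ᶻ s)) ≡ (-ᶻ + 2) *ᶻ (y -ᶻ (x +ᶻ d))
    identity = solve-∀
  centred-shift s d (x , true) = combine₁ (+ 2)
    (⟦[]⟧ (⟦ x ⟧ -ᶻ ⟦ suc d ⟧)) (identity ⟦ [ ⟦ x ⟧ -ᶻ ⟦ suc d ⟧ ] ⟧ ⟦ s ⟧ ⟦ x ⟧ ⟦ suc d ⟧)
    where
    identity : ∀ y s x d → (y +ᶻ y -ᶻ s) -ᶻ ((-ᶻ (+ 2 *ᶻ d)) -ᶻ (s -ᶻ (x +ᶻ x))) ≡ + 2 *ᶻ (y -ᶻ (x -ᶻ d))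
    identity = solve-∀

  2d≉0 : ∀ (d : Fin p-1) → ¬ + 2 *ᶻ ⟦ suc d ⟧ ≈ 0ℤ
  2d≉0 d e = [ (λ 2≈0 → contradiction (residue-unique (s≤s (s≤s (s≤s z≤n))) (s≤s z≤n) 2≈0) 1+n≢0)
             , (λ d≈0 → contradiction (residue-unique (Fin.toℕ<n (suc d)) (s≤s z≤n) d≈0) 1+n≢0)
             ]′ (*-≈0 (+ 2) ⟦ suc d ⟧ e)

  mixed : ∀ s d → Projection (inj₁ s) (inj₂ d)
  mixed s d = record
    { w = centred s ; α = 0ℤ ; β = -ᶻ (+ 2 *ᶻ ⟦ suc d ⟧)
    ; w-c = centred-reflect s ; w-c′ = centred-shift s d
    ; α≉β = λ e → 2d≉0 d (combine₁ 1ℤ e (identity (+ 2 *ᶻ ⟦ suc d ⟧))) }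
    where
    identity : ∀ e → e -ᶻ 0ℤ ≡ 1ℤ *ᶻ (0ℤ -ᶻ (-ᶻ e))
    identity = solve-∀

  projection : ∀ {c c′} → c ≢ c′ → Projection c c′
  projection {inj₁ s} {inj₁ s′} c≢c′ = record
    { w = ⟦_⟧ ∘ proj₁ ; α = ⟦ s ⟧ ; β = ⟦ s′ ⟧
    ; w-c = λ (x , _) → reflect-≈ s x ; w-c′ = λ (x , _) → reflect-≈ s′ x
    ; α≉β = c≢c′ ∘ cong inj₁ ∘ ⟦⟧-injective }
  projection {inj₁ s} {inj₂ d} _ = mixed s d
  projection {inj₂ d} {inj₁ s} _ = Projection-sym (mixed s d)
  projection {inj₂ d} {inj₂ d′} c≢c′ = record
    { w = signed ; α = -ᶻ ⟦ suc d ⟧ ; β = -ᶻ ⟦ suc d′ ⟧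
    ; w-c = signed-shift d ; w-c′ = signed-shift d′
    ; α≉β = λ e → c≢c′ (cong inj₂ (Fin.suc-injective (⟦⟧-injective
        (combine₁ -1ℤ e (identity ⟦ suc d ⟧ ⟦ suc d′ ⟧))))) }
    where
    identity : ∀ d e → d -ᶻ e ≡ -1ℤ *ᶻ ((-ᶻ d) -ᶻ (-ᶻ e))
    identity = solve-∀

  orbit : Factor → Factor → Vertex → ℕ → Vertex
  orbit c c′ v zero    = v
  orbit c c′ v (suc k) = orbit c′ c (mate c v) k

  orbit-suc : ∀ c c′ v k → orbit c c′ v (suc k) ≡ mate (alternate c c′ k) (orbit c c′ v k)
  orbit-suc c c′ v zero    = refl
  orbit-suc c c′ v (suc k) = orbit-suc c′ c (mate c v) k

  orbit-projection : ∀ {c c′} (π : Projection c c′) v k → Projection.w π (orbit c c′ v k) ≈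
    reflections (Projection.α π) (Projection.β π) (Projection.w π v) k
  orbit-projection π v zero = ≈-reflexive refl
  orbit-projection {c} {c′} π v (suc k) = ≈-trans
    (orbit-projection (Projection-sym π) (mate c v) k)
    (reflections-cong β α k (w-c v))
    where open Projection π

  -- A stretch of odd length begins and ends with a step along the same factor. If its ends
  -- coincided, so would the vertices one step inside, and finally a mate would fix a vertex.
  orbit-parity : ∀ c c′ v j k → orbit c c′ v k ≢ orbit c c′ v (suc (j * 2) + k)
  orbit-parity c c′ v zero    k eq = mate-≢ _ _ (trans (sym (orbit-suc c c′ v k)) (sym eq))
  orbit-parity c c′ v (suc j) k eq = orbit-parity c c′ v j (suc k)
    (trans (orbit-suc c c′ v k) (trans (cong (mate (alternate c c′ k)) (trans eq eq′))
      (trans (mate-involutive _ _) (cong (orbit c c′ v) (sym (+-suc (suc (j * 2)) k))))))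
    where
    eq′ : orbit c c′ v (suc (suc j * 2) + k) ≡ mate (alternate c c′ k) (orbit c c′ v (suc (suc (j * 2)) + k))
    eq′ = trans (orbit-suc c c′ v (suc j * 2 + k))
      (cong (λ a → mate a (orbit c c′ v (suc j * 2 + k))) (alternate-shift c c′ (suc j) k))

  orbit-parity′ : ∀ c c′ v i j → orbit c c′ v (i * 2) ≢ orbit c c′ v (suc (j * 2))
  orbit-parity′ c c′ v i j eq = [ below , above ]′ (<-≤-connex j i)
    where
    below : j < i → _
    below j<i with e , refl ← m≤n⇒∃[o]m+o≡n j<i = orbit-parity c c′ v e (suc (j * 2))
      (trans (sym eq) (cong (orbit c c′ v) (identity j e)))
      where
      identity : ∀ j e → (suc j + e) * 2 ≡ suc (e * 2) + suc (j * 2)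
      identity = solveℕ-∀
    above : i ≤ j → _
    above i≤j with e , refl ← m≤n⇒∃[o]m+o≡n i≤j = orbit-parity c c′ v e (i * 2)
      (trans eq (cong (orbit c c′ v) (identity i e)))
      where
      identity : ∀ i e → suc ((i + e) * 2) ≡ suc (e * 2) + i * 2
      identity = solveℕ-∀

  -- The projection separates times of equal parity. Times of opposite parity are separated by
  -- closing in on an edge from both ends, since mate c has no fixed points.
  orbit-injective : ∀ {c c′} → c ≢ c′ → ∀ v {k l} → k < p * 2 → l < p * 2 →
    orbit c c′ v k ≡ orbit c c′ v l → k ≡ l
  orbit-injective {c} {c′} c≢c′ v {k} {l} = cases (halve k) (halve l)
    where
    π = projection c≢c′
    π′ = Projection-sym π
    projected : ∀ {c c′ v k l} (π : Projection c c′) → orbit c c′ v k ≡ orbit c c′ v l →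
      let open Projection π in reflections α β (w v) k ≈ reflections α β (w v) l
    projected {v = v} {k} {l} π eq = ≈-trans (≈-sym (orbit-projection π v k))
      (≈-trans (≈-reflexive (cong (Projection.w π) eq)) (orbit-projection π v l))
    cases : ∀ {k l} → ∃[ i ] (k ≡ i * 2 ⊎ k ≡ suc (i * 2)) → ∃[ j ] (l ≡ j * 2 ⊎ l ≡ suc (j * 2)) →
      k < p * 2 → l < p * 2 → orbit c c′ v k ≡ orbit c c′ v l → k ≡ l
    cases (i , inj₁ refl) (j , inj₁ refl) k< l< eq = cong (_* 2) (evens-distinct (Projection.α≉β π) (Projection.w π v)
      (half-< i ≤-refl k<) (half-< j ≤-refl l<) (projected {k = i * 2} {j * 2} π eq))
    cases (i , inj₂ refl) (j , inj₂ refl) k< l< eq = cong (λ q → suc (q * 2))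
      (evens-distinct (Projection.α≉β π′) (Projection.w π (mate c v)) (half-< i (n≤1+n _) k<) (half-< j (n≤1+n _) l<)
        (projected {v = mate c v} {i * 2} {j * 2} π′ eq))
    cases (i , inj₁ refl) (j , inj₂ refl) k< l< eq = contradiction eq (orbit-parity′ c c′ v i j)
    cases (i , inj₂ refl) (j , inj₁ refl) k< l< eq = contradiction (sym eq) (orbit-parity′ c c′ v j i)

  n : ℕ
  n = p + p-1

  deleted : Vertex
  deleted = zero , true

  embed : Fin n → Vertex
  embed = [ (_, false) , (λ y → suc y , true) ]′ ∘ splitAt p

  -- The value at the deleted vertex is irrelevant.
  retract : Vertex → Fin n
  retract (x     , false) = x ↑ˡ p-1
  retract (zero  , true)  = zero
  retract (suc y , true)  = p ↑ʳ y

  embed-retract : ∀ {v} → v ≢ deleted → embed (retract v) ≡ v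
  embed-retract {x     , false} _ rewrite Fin.splitAt-↑ˡ p x p-1 = refl
  embed-retract {zero  , true}  v≢deleted = contradiction refl v≢deleted
  embed-retract {suc y , true}  _ rewrite Fin.splitAt-↑ʳ p p-1 y = refl

  -- There are `p + (p - 1)` factors, as many as vertices left after the deletion, so one splitting
  -- of `Fin n` codes both.
  toFactor : Fin n → Factor
  toFactor = splitAt p

  fromFactor : Factor → Fin n
  fromFactor = join p p-1

  from-to : ∀ a → fromFactor (toFactor a) ≡ a
  from-to = Fin.join-splitAt p p-1

  toFactor-≢ : ∀ {a b} → a ≢ b → toFactor b ≢ toFactor a
  toFactor-≢ {a} {b} a≢b eq = a≢b (trans (sym (from-to a)) (trans (cong fromFactor (sym eq)) (from-to b)))

  -- `b` comes first because the step out of the deleted vertex is cut off, so that the remaining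
  -- path opens with colour `a`.
  cycle : Fin n → Fin n → ℕ → Vertex
  cycle a b = orbit (toFactor b) (toFactor a) deleted

  suc-bound : ∀ {k} → k < n → suc k < p * 2
  suc-bound {k} k<n = subst (suc k <_) (identity q) (s≤s k<n)
    where
    identity : ∀ q → suc ((3 + q) + (2 + q)) ≡ (3 + q) * 2
    identity = solveℕ-∀

  cycle-≢ : ∀ {a b} → a ≢ b → ∀ {k} → k < n → cycle a b (suc k) ≢ deleted
  cycle-≢ a≢b k<n eq = 1+n≢0 (orbit-injective (toFactor-≢ a≢b) deleted (suc-bound k<n) (s≤s z≤n) eq)

  colouring : PerfectColouring n
  colouring = record
    { colour         = λ u v → fromFactor (factor (embed u) (embed v))
    ; colour-sym     = λ u v → cong fromFactor (factor-sym (embed u) (embed v))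
    ; path           = λ a b k → retract (cycle a b (suc k))
    ; path-injective = λ a≢b k<n l<n eq → suc-injective (orbit-injective (toFactor-≢ a≢b) deleted
        (suc-bound k<n) (suc-bound l<n) (trans (sym (embed-retract (cycle-≢ a≢b k<n)))
          (trans (cong embed eq) (embed-retract (cycle-≢ a≢b l<n)))))
    ; path-colour    = path-colour
    }
    where
    path-colour : ∀ {a b} → a ≢ b → ∀ k → suc k < n →
      fromFactor (factor (embed (retract (cycle a b (suc k)))) (embed (retract (cycle a b (suc (suc k))))))
        ≡ alternate a b k
    path-colour {a} {b} a≢b k 1+k<n = begin
      fromFactor (factor (embed (retract (cycle a b (suc k)))) (embed (retract (cycle a b (suc (suc k))))))
        ≡⟨ cong₂ (λ u v → fromFactor (factor u v)) (embed-retract (cycle-≢ a≢b (<-trans (n<1+n k) 1+k<n)))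
             (embed-retract (cycle-≢ a≢b 1+k<n)) ⟩
      fromFactor (factor (cycle a b (suc k)) (cycle a b (suc (suc k))))
        ≡⟨ cong (fromFactor ∘ factor (cycle a b (suc k))) (orbit-suc (toFactor b) (toFactor a) deleted (suc k)) ⟩
      fromFactor (factor (cycle a b (suc k)) (mate (alternate (toFactor a) (toFactor b) k) (cycle a b (suc k))))
        ≡⟨ cong fromFactor (mate-factor (alternate (toFactor a) (toFactor b) k) (cycle a b (suc k))) ⟩
      fromFactor (alternate (toFactor a) (toFactor b) k)
        ≡⟨ alternate-map fromFactor (toFactor a) (toFactor b) k ⟩
      alternate (fromFactor (toFactor a)) (fromFactor (toFactor b)) k
        ≡⟨ cong₂ (λ a b → alternate a b k) (from-to a) (from-to b) ⟩
      alternate a b k ∎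
      where open ≡-Reasoning

-- Primes and logarithms

prime-divisor : ∀ n → 1 < n → ∃[ p ] Prime p × p ∣ n
prime-divisor n 1<n = first (PrimeFactorisation.factors f) (PrimeFactorisation.isFactorisation f)
  (PrimeFactorisation.factorsPrime f)
  where
  f : PrimeFactorisation n
  f = factorise n {{>-nonZero (<-trans z<s 1<n)}}
  first : ∀ ps → n ≡ product ps → All Prime ps → ∃[ p ] Prime p × p ∣ n
  first []       n≡1  _              = contradiction n≡1 (>⇒≢ 1<n)
  first (p ∷ ps) n≡ps (p-prime ∷ _) = p , p-prime , subst (p ∣_) (sym n≡ps) (m∣m*n (product ps))

p∣p! : ∀ p .{{_ : NonZero p}} → p ∣ p !
p∣p! (suc p) = m∣m*n (p !)

-- Euclid's argument: a prime factor of `N ! + 1` cannot divide `N !`.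
prime-above : ∀ N → ∃[ p ] N < p × Prime p
prime-above N with prime-divisor (N ! + 1) (+-mono-≤ (1≤n! N) ≤-refl)
... | p , p-prime , p∣N!+1 = p , ≰⇒> (λ p≤N → contradiction
    (subst Prime (∣1⇒≡1 (∣m+n∣m⇒∣n p∣N!+1 (∣-trans p∣p!′ (m≤n⇒m!∣n! p≤N)))) p-prime) ¬prime[1])
  , p-prime
  where p∣p!′ = p∣p! p {{prime⇒nonZero p-prime}}

prime>2⇒odd : ∀ {p} → 2 < p → Prime p → 2 ∤ p
prime>2⇒odd 2<p p-prime 2∣p =
  [ (λ ()) , <⇒≢ 2<p ]′ (prime⇒irreducible p-prime 2∣p)

odd⇒1+2h : ∀ {p} → 2 ∤ p → ∃[ h ] p ≡ suc (h * 2)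
odd⇒1+2h {p} 2∤p with halve p
... | h , inj₁ p≡2h = contradiction (Nat.divides h p≡2h) 2∤p
... | h , inj₂ p≡   = h , p≡

-- As the upper bound is not strict, `suc L` is the logarithm rounded up, a sufficient number of
-- digits for the colours; the lower bound lets `L` replace the logarithm in the hypothesis.
log₂-bracket : ∀ n → ∃[ L ] 2 ^ L ≤ 2 + n × 2 + n ≤ 2 ^ suc L
log₂-bracket zero    = 0 , s≤s z≤n , ≤-refl
log₂-bracket (suc n) with log₂-bracket n
... | L , lower , upper with m≤n⇒m<n∨m≡n upper
...   | inj₁ 2+n<2^1+L = L , m≤n⇒m≤1+n lower , 2+n<2^1+L
...   | inj₂ 2+n≡2^1+L = suc L , m≤n⇒m≤1+n (≤-reflexive (sym 2+n≡2^1+L)) ,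
  subst (λ q → suc q ≤ 2 ^ suc (suc L)) (sym 2+n≡2^1+L) (^-monoʳ-< 2 (s≤s (s≤s z≤n)) (n<1+n (suc L)))

^-cancelʳ-≤ : ∀ {k l} → 2 ^ k ≤ 2 ^ l → k ≤ l
^-cancelʳ-≤ {k} {l} 2^k≤2^l = ≮⇒≥ λ l<k → <⇒≱ (^-monoʳ-< 2 (s≤s (s≤s z≤n)) l<k) 2^k≤2^l

-- The factor 12 is 3 times 4, from `2 (L + 1) ≤ 3L` and `3t + 1 ≤ 4t`.
block-count : ∀ {L t} → 2 ≤ L → 1 ≤ t → suc L * suc (3 * t) * 2 ≤ L * (12 * t)
block-count {L} {t} 2≤L 1≤t = begin
  suc L * suc (3 * t) * 2   ≡⟨ rearrange (suc L) (suc (3 * t)) ⟩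
  suc L * 2 * suc (3 * t)   ≤⟨ *-mono-≤ 1+L*2≤L*3 (+-monoˡ-≤ (3 * t) 1≤t) ⟩
  L * 3 * (t + 3 * t)       ≡⟨ collect L t ⟩
  L * (12 * t)              ∎
  where
  open ≤-Reasoning
  rearrange : ∀ a b → a * b * 2 ≡ a * 2 * b
  rearrange = solveℕ-∀
  collect : ∀ L t → L * 3 * (t + 3 * t) ≡ L * (12 * t)
  collect = solveℕ-∀
  split : ∀ L → L * 3 ≡ L + L * 2
  split = solveℕ-∀
  1+L*2≤L*3 : suc L * 2 ≤ L * 3
  1+L*2≤L*3 = ≤-trans (+-monoˡ-≤ (L * 2) 2≤L) (≤-reflexive (sym (split L)))

perfectColouring⇒lowerBound : ∀ {n} → 5 ≤ n → PerfectColouring n → LowerBound n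
perfectColouring⇒lowerBound {suc (suc M)} 5≤n C (suc (suc t)) 3≤ℓ n^12t≤2^[n-1]
  with L , lower , upper ← log₂-bracket M =
  code⇒M (s≤s (s≤s z≤n)) (Family.hasCode C t (suc L) (≤-trans (n≤1+n (suc M)) upper) blocks
    (≤-trans (*-monoˡ-≤ 2 (m≤n*m (suc (3 * t)) (suc L))) blocks))
  where
  blocks : suc L * suc (3 * t) * 2 ≤ 2 + M
  -- Since `2 ^ L ≤ n`, the hypothesis gives `2 ^ (L * (12 * t)) ≤ 2 ^ (n - 1)`, and exponents can
  -- be compared.
  blocks = ≤-trans (block-count 2≤L (s≤s⁻¹ (s≤s⁻¹ 3≤ℓ))) (m≤n⇒m≤1+n (^-cancelʳ-≤ (begin
    2 ^ (L * (12 * t))   ≡⟨ ^-*-assoc 2 L (12 * t) ⟨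
    (2 ^ L) ^ (12 * t)   ≤⟨ ^-monoˡ-≤ (12 * t) lower ⟩
    (2 + M) ^ (12 * t)   ≤⟨ n^12t≤2^[n-1] ⟩
    2 ^ suc M            ∎)))
    where
    open ≤-Reasoning
    2≤L : 2 ≤ L
    -- For `L < 2` the upper bracket would give `n ≤ 4`.
    2≤L = ≮⇒≥ λ L<2 → <⇒≱ 5≤n (≤-trans upper (^-monoʳ-≤ 2 L<2))
perfectColouring⇒lowerBound {suc zero} (s≤s ())
perfectColouring⇒lowerBound {suc (suc M)} _ _ (suc zero) (s≤s ())

lowerBound-odd-prime : ∀ {n p} → 5 ≤ n → Prime p → 2 ∤ p → n ≡ p ⊎ n ≡ 2 * p ∸ 1 → LowerBound n
lowerBound-odd-prime 5≤n p-prime 2∤p (inj₁ refl) with odd⇒1+2h 2∤p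
... | h , p≡ = perfectColouring⇒lowerBound 5≤n (SumColouring.colouring _ p-prime h p≡)
lowerBound-odd-prime {p = 0} _ p-prime _ _ = contradiction p-prime ¬prime[0]
lowerBound-odd-prime {p = 1} _ p-prime _ _ = contradiction p-prime ¬prime[1]
lowerBound-odd-prime {p = 2} _ _ 2∤p _ = contradiction ∣-refl 2∤p
lowerBound-odd-prime {n} {p = suc (suc (suc q))} 5≤n p-prime 2∤p (inj₂ n≡) =
  perfectColouring⇒lowerBound 5≤n
    (subst PerfectColouring (trans (identity q) (sym n≡)) (LayerColouring.colouring q p-prime))
  where
  identity : ∀ q → (3 + q) + (2 + q) ≡ 2 + q + (3 + q + 0)
  identity = solveℕ-∀

theorem1p2 : (∀ (N : ℕ) → ∃[ n ] N < n × LowerBound n)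
    × (∀ (n p : ℕ) → 64 ≤ n → Prime p → 2 ∤ p → n ≡ p ⊎ n ≡ 2 * p ∸ 1 → LowerBound n)
theorem1p2 =
  -- The added 4 makes the prime at least 5, as `lowerBound-odd-prime` requires.
  (λ N → let p , 4+N<p , p-prime = prime-above (4 + N)
             4<p = ≤-trans (s≤s (m≤m+n 4 N)) 4+N<p in
    p , ≤-trans (s≤s (m≤n+m N 4)) 4+N<p ,
    lowerBound-odd-prime 4<p p-prime (prime>2⇒odd (<-trans (s≤s (s≤s (s≤s z≤n))) 4<p) p-prime) (inj₁ refl)) ,
  λ n p 64≤n → lowerBound-odd-prime (≤-trans (m≤m+n 5 59) 64≤n)
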